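{- As an identity of formal power series in $x,y,q$, \begin{align*} &(-xq;q^2)_\infty (-yq^2;q^4)_\infty\\ &\quad= \sum_{n_1,n_2,n_3,n_4\ge 0}\frac{x^{n_1+n_2+2n_4}y^{n_2+n_3}q^{n_1+3n_2+2n_3+4n_4}\left(1+x^2yq^{6+8(n_1+n_2+n_3+n_4)}\right)}{(q^2;q^2)_{n_1}(q^2;q^2)_{n_2}(q^4;q^4)_{n_3}(q^4;q^4)_{n_4}}\\ &\quad\quad\times q^{4\binom{n_1}{2}+6\binom{n_2}{2}+4\binom{n_3}{2}+8\binom{n_4}{2}+4n_1n_2+4n_1n_3+4n_1n_4+4n_2n_3+4n_2n_4+4n_3n_4}. \end{align*}
   Context: For $n\in\mathbb{N}\cup\{\infty\}$, $(A;q)_n:=\prod_{k=0}^{n-1}(1-Aq^k)$ (the $q$-Pochhammer symbol). -}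

module Defs where

open import Data.Nat as ℕ using (ℕ; zero; suc; _∸_; _≡ᵇ_)
open import Data.Nat.Combinatorics using (_C_)
open import Data.Integer using (ℤ; 0ℤ; 1ℤ; _+_; _*_)
open import Data.Bool using (Bool; true; false; if_then_else_; _∧_)
open import Data.List using (upTo)
open import Data.Bool.ListAction using (any)

-- A formal power series in x, y, q with integer coefficients:
-- S a b m is the coefficient of x^a y^b q^m.
Series : Set
Series = ℕ → ℕ → ℕ → ℤ

sumLe : ℕ → (ℕ → ℤ) → ℤ
sumLe zero f = f 0
sumLe (suc n) f = sumLe n f + f (suc n)

sumLt : ℕ → (ℕ → ℤ) → ℤ
sumLt zero f = 0ℤ
sumLt (suc n) f = sumLt n f + f n

infixl 6 _⊕_
infixl 7 _⊗_

_⊕_ : Series → Series → Series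
(f ⊕ g) a b m = f a b m + g a b m

_⊗_ : Series → Series → Series
(f ⊗ g) a b m =
  sumLe a λ i → sumLe b λ j → sumLe m λ k → f i j k * g (a ∸ i) (b ∸ j) (m ∸ k)

mono : ℕ → ℕ → ℕ → Series
mono e f g a b m = if (a ≡ᵇ e) ∧ (b ≡ᵇ f) ∧ (m ≡ᵇ g) then 1ℤ else 0ℤ

one : Series
one = mono 0 0 0

-- geo d = 1/(1 - q^d) = Σ_{j ≥ 0} q^{d j}   (used with d ≥ 1)
geo : ℕ → Series
geo d a b m =
  if (a ≡ᵇ 0) ∧ (b ≡ᵇ 0) ∧ any (λ j → (d ℕ.* j) ≡ᵇ m) (upTo (suc m)) then 1ℤ else 0ℤ

prodLt : ℕ → (ℕ → Series) → Series
prodLt zero F = one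
prodLt (suc N) F = prodLt N F ⊗ F N

invPoch : ℕ → ℕ → Series
invPoch s n = prodLt n (λ i → geo (s ℕ.* suc i))

sumSeriesLt : ℕ → (ℕ → Series) → Series
sumSeriesLt N F a b m = sumLt N (λ i → F i a b m)

lhsTrunc : ℕ → Series
lhsTrunc N =
  prodLt N (λ k → one ⊕ mono 1 0 (2 ℕ.* k ℕ.+ 1))
  ⊗ prodLt N (λ k → one ⊕ mono 0 1 (4 ℕ.* k ℕ.+ 2))

rhsTerm : ℕ → ℕ → ℕ → ℕ → Series
rhsTerm n₁ n₂ n₃ n₄ =
  mono (n₁ ℕ.+ n₂ ℕ.+ 2 ℕ.* n₄)
       (n₂ ℕ.+ n₃)
       (n₁ ℕ.+ 3 ℕ.* n₂ ℕ.+ 2 ℕ.* n₃ ℕ.+ 4 ℕ.* n₄ ℕ.+ E)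
  ⊗ (one ⊕ mono 2 1 (6 ℕ.+ 8 ℕ.* (n₁ ℕ.+ n₂ ℕ.+ n₃ ℕ.+ n₄)))
  ⊗ invPoch 2 n₁ ⊗ invPoch 2 n₂ ⊗ invPoch 4 n₃ ⊗ invPoch 4 n₄
  where
  E : ℕ
  E = 4 ℕ.* (n₁ C 2) ℕ.+ 6 ℕ.* (n₂ C 2) ℕ.+ 4 ℕ.* (n₃ C 2) ℕ.+ 8 ℕ.* (n₄ C 2)
      ℕ.+ 4 ℕ.* n₁ ℕ.* n₂ ℕ.+ 4 ℕ.* n₁ ℕ.* n₃ ℕ.+ 4 ℕ.* n₁ ℕ.* n₄
      ℕ.+ 4 ℕ.* n₂ ℕ.* n₃ ℕ.+ 4 ℕ.* n₂ ℕ.* n₄ ℕ.+ 4 ℕ.* n₃ ℕ.* n₄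

rhsTrunc : ℕ → Series
rhsTrunc N =
  sumSeriesLt N λ n₁ → sumSeriesLt N λ n₂ → sumSeriesLt N λ n₃ → sumSeriesLt N λ n₄ →
  rhsTerm n₁ n₂ n₃ n₄

{-# OPTIONS --safe #-}
module Submission where

-- Write H(u₁,u₂,u₃,u₄) for the multisum without the factor 1 + x²y⋯, with u₁ = xq, u₂ = xyq³,
-- u₃ = yq², u₄ = x²q⁴ regarded as independent weights. Raising one summation index by one and
-- using 1/(q^s;q^s)_n - q^(sn)/(q^s;q^s)_n = 1/(q^s;q^s)_(n-1) gives four contiguous relations
--   H = H(q²u₁,u₂,u₃,u₄) + u₁ H(q⁴u₁,q⁴u₂,q⁴u₃,q⁴u₄),
--   H = H(u₁,q²u₂,u₃,u₄) + u₂ H(q⁴u₁,q⁶u₂,q⁴u₃,q⁴u₄),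
--   H = H(u₁,u₂,q⁴u₃,u₄) + u₃ H(q⁴u₁,q⁴u₂,q⁴u₃,q⁴u₄),
--   H = H(u₁,u₂,u₃,q⁴u₄) + u₄ H(q⁴u₁,q⁴u₂,q⁴u₃,q⁸u₄).
-- The right-hand side is R(x,y) = H(u) + x²yq⁶ H(q⁸u), and eight instances of these relations
-- combine to R(x,y) = (1 + xq) R(xq²,y). Modulo q^N, iterating this N times splits off
-- (-xq;q²)_N and leaves R(0,y), which the third relation turns into (-yq²;q⁴)_N in the same way.

open import Defs
open import Algebra.Bundles using (CommutativeSemiring)
open import Data.Bool as Bool using (Bool; true; false; if_then_else_)
open import Data.Bool.ListAction using (any)
open import Data.Empty using (⊥-elim)
open import Data.Integer as ℤ using (ℤ; 0ℤ; 1ℤ)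
open import Data.List using (upTo)
open import Data.List.Membership.Propositional using (lose)
open import Data.List.Membership.Propositional.Properties using (∈-upTo⁺)
open import Data.List.Relation.Unary.Any using (satisfied)
open import Data.List.Relation.Unary.Any.Properties using (any⁺; any⁻)
open import Data.Nat as ℕ using (ℕ; zero; suc; _<_; _≤_; z≤n; s≤s; s<s⁻¹; _∸_; _≡ᵇ_)
open import Data.Nat.Combinatorics using (_C_; nC1≡n; nCk+nC[k+1]≡[n+1]C[k+1])
open import Data.Nat.Divisibility using (_∣_; divides; ∣m+n∣m⇒∣n; ∣m∣n⇒∣m+n; ∣-refl; >⇒∤; _∣0)
open import Data.Nat.Tactic.RingSolver using (solve-∀)
open import Data.Product using (_,_)
open import Data.Sum using (inj₁; inj₂)
open import Level using (0ℓ)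
open import Relation.Binary.PropositionalEquality as ≡ using (_≡_)
open import Relation.Binary.Structures using (IsEquivalence)
import Algebra.Properties.CommutativeSemiring.Exp as Exp
import Algebra.Solver.CommutativeMonoid as CommutativeMonoidSolver
import Algebra.Solver.Ring.NaturalCoefficients.Default as SemiringSolver
import Algebra.Structures.Biased as Biased
import Data.Integer.Properties as ℤ
import Data.Nat.Properties as ℕ
import Relation.Binary.Reasoning.Setoid as SetoidReasoning

[1+n]C2≡n+nC2 : ∀ n → suc n C 2 ≡ n ℕ.+ n C 2
[1+n]C2≡n+nC2 n =
  ≡.trans (≡.sym (nCk+nC[k+1]≡[n+1]C[k+1] n 1)) (≡.cong (ℕ._+ n C 2) (nC1≡n n))

-- Finite sums and products over a commutative semiring.

module FiniteSums (K : CommutativeSemiring 0ℓ 0ℓ) where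
  open CommutativeSemiring K
  open SetoidReasoning setoid
  open SemiringSolver K using (solve; _:=_; _:+_; _:*_)

  ∑ ∏ : ℕ → (ℕ → Carrier) → Carrier
  ∑ zero    f = 0#
  ∑ (suc n) f = ∑ n f + f n
  ∏ zero    f = 1#
  ∏ (suc n) f = ∏ n f * f n

  ∑-cong : ∀ n {f g} → (∀ i → f i ≈ g i) → ∑ n f ≈ ∑ n g
  ∑-cong zero    f≈g = refl
  ∑-cong (suc n) f≈g = +-cong (∑-cong n f≈g) (f≈g n)

  ∑-zero : ∀ n {f} → (∀ i → f i ≈ 0#) → ∑ n f ≈ 0#
  ∑-zero zero    f≈0 = refl
  ∑-zero (suc n) f≈0 = trans (+-cong (∑-zero n f≈0) (f≈0 n)) (+-identityˡ 0#)

  ∑-distrib-+ : ∀ n f g → ∑ n (λ i → f i + g i) ≈ ∑ n f + ∑ n g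
  ∑-distrib-+ zero    f g = sym (+-identityˡ 0#)
  ∑-distrib-+ (suc n) f g = trans (+-congʳ (∑-distrib-+ n f g))
    (solve 4 (λ a b c d → (a :+ b) :+ (c :+ d) := (a :+ c) :+ (b :+ d)) refl _ _ _ _)

  *-distribˡ-∑ : ∀ n c f → c * ∑ n f ≈ ∑ n (λ i → c * f i)
  *-distribˡ-∑ zero    c f = zeroʳ c
  *-distribˡ-∑ (suc n) c f = trans (distribˡ c _ _) (+-congʳ (*-distribˡ-∑ n c f))

  ∑-suc : ∀ n f → ∑ (suc n) f ≈ f 0 + ∑ n (λ i → f (suc i))
  ∑-suc zero    f = +-comm 0# (f 0)
  ∑-suc (suc n) f = trans (+-congʳ (∑-suc n f)) (+-assoc _ _ _)

  ∑-head : ∀ n {f} → (∀ i → f (suc i) ≈ 0#) → ∑ (suc n) f ≈ f 0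
  ∑-head n {f} f≈0 = begin
    ∑ (suc n) f                     ≈⟨ ∑-suc n f ⟩
    f 0 + ∑ n (λ i → f (suc i))     ≈⟨ +-congˡ (∑-zero n f≈0) ⟩
    f 0 + 0#                        ≈⟨ +-identityʳ (f 0) ⟩
    f 0                             ∎

  -- The finite counterpart of shifting the index of an infinite sum. As `f n` and `g n` vanish, the
  -- sums of `f` and `g` may be extended by one term; removing their equal terms at 0 then leaves
  -- exactly `n` shifted terms.
  ∑-shift : ∀ n f {g h} → f n ≈ 0# → g n ≈ 0# → f 0 ≈ g 0 →
            (∀ i → f (suc i) ≈ g (suc i) + h i) → ∑ n f ≈ ∑ n g + ∑ n h
  ∑-shift n f {g} {h} fn≈0 gn≈0 f0≈g0 step = begin
    ∑ n f                                               ≈⟨ +-identityʳ _ ⟨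
    ∑ n f + 0#                                          ≈⟨ +-congˡ fn≈0 ⟨
    ∑ (suc n) f                                         ≈⟨ ∑-suc n f ⟩
    f 0 + ∑ n (λ i → f (suc i))                         ≈⟨ +-cong f0≈g0 (∑-cong n step) ⟩
    g 0 + ∑ n (λ i → g (suc i) + h i)                   ≈⟨ +-congˡ (∑-distrib-+ n _ h) ⟩
    g 0 + (∑ n (λ i → g (suc i)) + ∑ n h)               ≈⟨ +-assoc _ _ _ ⟨
    (g 0 + ∑ n (λ i → g (suc i))) + ∑ n h               ≈⟨ +-congʳ (∑-suc n g) ⟨
    (∑ n g + g n) + ∑ n h                               ≈⟨ +-congʳ (+-congˡ gn≈0) ⟩
    (∑ n g + 0#) + ∑ n h                                ≈⟨ +-congʳ (+-identityʳ _) ⟩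
    ∑ n g + ∑ n h                                       ∎

  ∑⁴ : ℕ → (ℕ → ℕ → ℕ → ℕ → Carrier) → Carrier
  ∑⁴ n f = ∑ n λ i → ∑ n λ j → ∑ n λ k → ∑ n λ l → f i j k l

  ∑⁴-cong : ∀ n {f g} → (∀ i j k l → f i j k l ≈ g i j k l) → ∑⁴ n f ≈ ∑⁴ n g
  ∑⁴-cong n f≈g = ∑-cong n λ i → ∑-cong n λ j → ∑-cong n λ k → ∑-cong n λ l → f≈g i j k l

  ∑-cong-+ : ∀ n {f g h} → (∀ i → f i ≈ g i + h i) → ∑ n f ≈ ∑ n g + ∑ n h
  ∑-cong-+ n f≈g+h = trans (∑-cong n f≈g+h) (∑-distrib-+ n _ _)

  ∑⁴-distrib-+ : ∀ n f g → ∑⁴ n (λ i j k l → f i j k l + g i j k l) ≈ ∑⁴ n f + ∑⁴ n g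
  ∑⁴-distrib-+ n f g = ∑-cong-+ n λ i → ∑-cong-+ n λ j → ∑-cong-+ n λ k → ∑-distrib-+ n _ _

  module _ (n : ℕ) {f g h : ℕ → ℕ → ℕ → ℕ → Carrier} where

    ∑⁴-shift₁ : (∀ j k l → f n j k l ≈ 0#) → (∀ j k l → g n j k l ≈ 0#) →
                (∀ j k l → f 0 j k l ≈ g 0 j k l) →
                (∀ i j k l → f (suc i) j k l ≈ g (suc i) j k l + h i j k l) →
                ∑⁴ n f ≈ ∑⁴ n g + ∑⁴ n h
    ∑⁴-shift₁ fn gn f0 step = ∑-shift n _
      (∑-zero n λ j → ∑-zero n λ k → ∑-zero n λ l → fn j k l)
      (∑-zero n λ j → ∑-zero n λ k → ∑-zero n λ l → gn j k l)
      (∑-cong n λ j → ∑-cong n λ k → ∑-cong n λ l → f0 j k l)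
      (λ i → ∑-cong-+ n λ j → ∑-cong-+ n λ k → ∑-cong-+ n λ l → step i j k l)

    ∑⁴-shift₂ : (∀ i k l → f i n k l ≈ 0#) → (∀ i k l → g i n k l ≈ 0#) →
                (∀ i k l → f i 0 k l ≈ g i 0 k l) →
                (∀ i j k l → f i (suc j) k l ≈ g i (suc j) k l + h i j k l) →
                ∑⁴ n f ≈ ∑⁴ n g + ∑⁴ n h
    ∑⁴-shift₂ fn gn f0 step = ∑-cong-+ n λ i → ∑-shift n _
      (∑-zero n λ k → ∑-zero n λ l → fn i k l)
      (∑-zero n λ k → ∑-zero n λ l → gn i k l)
      (∑-cong n λ k → ∑-cong n λ l → f0 i k l)
      (λ j → ∑-cong-+ n λ k → ∑-cong-+ n λ l → step i j k l)

    ∑⁴-shift₃ : (∀ i j l → f i j n l ≈ 0#) → (∀ i j l → g i j n l ≈ 0#) →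
                (∀ i j l → f i j 0 l ≈ g i j 0 l) →
                (∀ i j k l → f i j (suc k) l ≈ g i j (suc k) l + h i j k l) →
                ∑⁴ n f ≈ ∑⁴ n g + ∑⁴ n h
    ∑⁴-shift₃ fn gn f0 step = ∑-cong-+ n λ i → ∑-cong-+ n λ j → ∑-shift n _
      (∑-zero n λ l → fn i j l)
      (∑-zero n λ l → gn i j l)
      (∑-cong n λ l → f0 i j l)
      (λ k → ∑-cong-+ n λ l → step i j k l)

    ∑⁴-shift₄ : (∀ i j k → f i j k n ≈ 0#) → (∀ i j k → g i j k n ≈ 0#) →
                (∀ i j k → f i j k 0 ≈ g i j k 0) →
                (∀ i j k l → f i j k (suc l) ≈ g i j k (suc l) + h i j k l) →
                ∑⁴ n f ≈ ∑⁴ n g + ∑⁴ n h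
    ∑⁴-shift₄ fn gn f0 step = ∑-cong-+ n λ i → ∑-cong-+ n λ j → ∑-cong-+ n λ k → ∑-shift n _
      (fn i j k) (gn i j k) (f0 i j k) (step i j k)

  *-distribˡ-∑⁴ : ∀ n c f → c * ∑⁴ n f ≈ ∑⁴ n (λ i j k l → c * f i j k l)
  *-distribˡ-∑⁴ n c f =
    trans (*-distribˡ-∑ n c _) (∑-cong n λ i →
      trans (*-distribˡ-∑ n c _) (∑-cong n λ j →
        trans (*-distribˡ-∑ n c _) (∑-cong n λ k → *-distribˡ-∑ n c _)))

-- The abstract setting: a semiring with q and inverses of the 1 - q^d.

module _ (K : CommutativeSemiring 0ℓ 0ℓ) where
  open CommutativeSemiring K
  open Exp K

  -- γ d plays the role of 1/(1 - q^d), characterised without subtraction.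
  InvertsOneMinusPowers : Carrier → (ℕ → Carrier) → Set
  InvertsOneMinusPowers q γ = ∀ d → γ (suc d) ≈ 1# + q ^ suc d * γ (suc d)

  PowerVanishes : ℕ → Carrier → Set
  PowerVanishes n u = u ^ n ≈ 0#

-- Nilpotency of q makes the infinite sums and products finite.
module Multisum
  (K : CommutativeSemiring 0ℓ 0ℓ)
  (q : CommutativeSemiring.Carrier K) (γ : ℕ → CommutativeSemiring.Carrier K)
  (γ-unfold : InvertsOneMinusPowers K q γ)
  (M : ℕ) (q^N≈0 : PowerVanishes K (suc M) q)
  where

  open CommutativeSemiring K
  open Exp K
  open FiniteSums K public
  open SetoidReasoning setoid
  private
    module ⊛ = CommutativeMonoidSolver *-commutativeMonoid
    module ⊞ = SemiringSolver K
    N = suc M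

  Small : Carrier → Set
  Small = PowerVanishes K N

  small-*ˡ : ∀ {u} v → Small u → Small (u * v)
  small-*ˡ {u} v u^N≈0 = begin
    (u * v) ^ N    ≈⟨ ^-distrib-* u v N ⟩
    u ^ N * v ^ N  ≈⟨ *-congʳ u^N≈0 ⟩
    0# * v ^ N     ≈⟨ zeroˡ _ ⟩
    0#             ∎

  -- All four weights carry a positive power of q, so nilpotency of q alone bounds all four
  -- summation indices.
  small-*q^ : ∀ u k → Small (u * q ^ suc k)
  small-*q^ u k = begin
    (u * (q * q ^ k)) ^ N  ≈⟨ ^-congˡ N (⊛.solve 3 (λ a b c → a ⊛.⊕ (b ⊛.⊕ c) ⊛.⊜ b ⊛.⊕ (a ⊛.⊕ c)) refl u q (q ^ k)) ⟩
    (q * (u * q ^ k)) ^ N  ≈⟨ small-*ˡ _ q^N≈0 ⟩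
    0#                     ∎

  -- Factors of the summand that depend on a single index.

  invPochhammer : ℕ → ℕ → Carrier
  invPochhammer s n = ∏ n (λ i → γ (s ℕ.* suc i))

  -- The share of one index `n` in the summand: q^s is the base of its Pochhammer symbol and `c` the
  -- coefficient of the binomial in its exponent.
  φ : ℕ → ℕ → Carrier → ℕ → Carrier
  φ s c u n = u ^ n * (q ^ (c ℕ.* (n C 2)) * invPochhammer s n)

  φ-cong : ∀ s c {u v} → u ≈ v → ∀ n → φ s c u n ≈ φ s c v n
  φ-cong s c u≈v n = *-congʳ (^-congˡ n u≈v)

  -- Read from right to left, this absorbs a power of q that is linear in `n` into the weight; such
  -- powers arise from the cross terms when another index is raised.
  φ-*q^ : ∀ s c u k n → φ s c (u * q ^ k) n ≈ q ^ (k ℕ.* n) * φ s c u n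
  φ-*q^ s c u k n = begin
    (u * q ^ k) ^ n * _            ≈⟨ *-congʳ (trans (^-distrib-* u (q ^ k) n) (*-congˡ (^-assocʳ q k n))) ⟩
    (u ^ n * q ^ (k ℕ.* n)) * _    ≈⟨ ⊛.solve 3 (λ a b c → (a ⊛.⊕ b) ⊛.⊕ c ⊛.⊜ b ⊛.⊕ (a ⊛.⊕ c)) refl _ _ _ ⟩
    q ^ (k ℕ.* n) * φ s c u n      ∎

  φ-small : ∀ s c {u} → Small u → φ s c u N ≈ 0#
  φ-small s c u^N≈0 = trans (*-congʳ u^N≈0) (zeroˡ _)

  -- Unfold the last factor γ = 1 + q^(s(n+1)) γ of the inverse Pochhammer symbol, with s for
  -- `suc s`. The second part multiplies the weight by q^s; the first cancels that factor and lowers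
  -- the index to `n`, the exponent c n left over from the binomial multiplying the weight by q^c.
  -- The base is a successor so that γ is taken at a positive index.
  φ-suc : ∀ s c u n → φ (suc s) c u (suc n) ≈
          φ (suc s) c (u * q ^ suc s) (suc n) + u * φ (suc s) c (u * q ^ c) n
  φ-suc s c u n = begin
    u ^ suc n * (Q′ * (I * g))
      ≈⟨ *-congˡ (*-congˡ (*-congˡ (γ-unfold _))) ⟩
    u ^ suc n * (Q′ * (I * (1# + q^s * g)))
      ≈⟨ ⊞.solve 5 (λ w P I r g → w ⊞.:* (P ⊞.:* (I ⊞.:* (⊞.con 1 ⊞.:+ r ⊞.:* g)))
           ⊞.:= r ⊞.:* (w ⊞.:* (P ⊞.:* (I ⊞.:* g))) ⊞.:+ w ⊞.:* (P ⊞.:* I))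
           refl (u ^ suc n) Q′ I q^s g ⟩
    q^s * φ (suc s) c u (suc n) + u ^ suc n * (Q′ * I)
      ≈⟨ +-cong (sym (φ-*q^ (suc s) c u (suc s) (suc n))) (*-congˡ (*-congʳ Q′≈)) ⟩
    φ (suc s) c (u * q ^ suc s) (suc n) + (u * u ^ n) * ((q ^ (c ℕ.* n) * Q) * I)
      ≈⟨ +-congˡ (⊛.solve 5 (λ u w P Q I → (u ⊛.⊕ w) ⊛.⊕ ((P ⊛.⊕ Q) ⊛.⊕ I)
           ⊛.⊜ u ⊛.⊕ (P ⊛.⊕ (w ⊛.⊕ (Q ⊛.⊕ I)))) refl u (u ^ n) (q ^ (c ℕ.* n)) Q I) ⟩
    φ (suc s) c (u * q ^ suc s) (suc n) + u * (q ^ (c ℕ.* n) * φ (suc s) c u n)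
      ≈⟨ +-congˡ (*-congˡ (φ-*q^ (suc s) c u c n)) ⟨
    φ (suc s) c (u * q ^ suc s) (suc n) + u * φ (suc s) c (u * q ^ c) n ∎
    where
    I = invPochhammer (suc s) n
    g = γ (suc s ℕ.* suc n)
    q^s = q ^ (suc s ℕ.* suc n)
    Q = q ^ (c ℕ.* (n C 2))
    Q′ = q ^ (c ℕ.* (suc n C 2))
    Q′≈ : Q′ ≈ q ^ (c ℕ.* n) * Q
    Q′≈ = trans (^-congʳ q (≡.trans (≡.cong (c ℕ.*_) ([1+n]C2≡n+nC2 n)) (ℕ.*-distribˡ-+ c n _)))
                (^-homo-* q (c ℕ.* n) _)

  -- The multisum H with independent weights.

  cross : ℕ → ℕ → Carrier
  cross i j = q ^ (4 ℕ.* i ℕ.* j)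

  cross-sucˡ : ∀ i j → cross (suc i) j ≈ q ^ (4 ℕ.* j) * cross i j
  cross-sucˡ i j = trans (^-congʳ q (eq i j)) (^-homo-* q (4 ℕ.* j) _)
    where
    eq : ∀ i j → 4 ℕ.* suc i ℕ.* j ≡ 4 ℕ.* j ℕ.+ 4 ℕ.* i ℕ.* j
    eq = solve-∀

  cross-sucʳ : ∀ i j → cross i (suc j) ≈ q ^ (4 ℕ.* i) * cross i j
  cross-sucʳ i j = trans (^-congʳ q (eq i j)) (^-homo-* q (4 ℕ.* i) _)
    where
    eq : ∀ i j → 4 ℕ.* i ℕ.* suc j ≡ 4 ℕ.* i ℕ.+ 4 ℕ.* i ℕ.* j
    eq = solve-∀

  crossings : ℕ → ℕ → ℕ → ℕ → Carrier
  crossings i j k l = cross i j * cross i k * cross i l * cross j k * cross j l * cross k l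

  T : (u₁ u₂ u₃ u₄ : Carrier) → ℕ → ℕ → ℕ → ℕ → Carrier
  T u₁ u₂ u₃ u₄ i j k l = φ 2 4 u₁ i * φ 2 6 u₂ j * φ 4 4 u₃ k * φ 4 8 u₄ l * crossings i j k l

  -- The multisum with independent weights u₁, …, u₄ in place of xq, xyq³, yq², x²q⁴. It is opaque
  -- since unfolding it would make conversion checking in the functional equation intractable.
  opaque
    H : (u₁ u₂ u₃ u₄ : Carrier) → Carrier
    H u₁ u₂ u₃ u₄ = ∑⁴ N (T u₁ u₂ u₃ u₄)

    H-unfold : ∀ {u₁ u₂ u₃ u₄} → H u₁ u₂ u₃ u₄ ≡ ∑⁴ N (T u₁ u₂ u₃ u₄)
    H-unfold = ≡.refl

  T-cong : ∀ {u₁ u₂ u₃ u₄ v₁ v₂ v₃ v₄} → u₁ ≈ v₁ → u₂ ≈ v₂ → u₃ ≈ v₃ → u₄ ≈ v₄ →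
           ∀ i j k l → T u₁ u₂ u₃ u₄ i j k l ≈ T v₁ v₂ v₃ v₄ i j k l
  T-cong e₁ e₂ e₃ e₄ i j k l = *-congʳ
    (*-cong (*-cong (*-cong (φ-cong 2 4 e₁ i) (φ-cong 2 6 e₂ j)) (φ-cong 4 4 e₃ k)) (φ-cong 4 8 e₄ l))

  opaque
    unfolding H

    H-cong : ∀ {u₁ u₂ u₃ u₄ v₁ v₂ v₃ v₄} → u₁ ≈ v₁ → u₂ ≈ v₂ → u₃ ≈ v₃ → u₄ ≈ v₄ →
             H u₁ u₂ u₃ u₄ ≈ H v₁ v₂ v₃ v₄
    H-cong e₁ e₂ e₃ e₄ = ∑⁴-cong N (T-cong e₁ e₂ e₃ e₄)

  -- Raising one index produces a factor q^4 to the power of each of the other three indices. These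
  -- factors account for the multiplications by q^4 of the other three weights in the contiguous
  -- relations.
  crossings-suc₁ : ∀ i j k l → crossings (suc i) j k l ≈
    (q ^ (4 ℕ.* j) * q ^ (4 ℕ.* k) * q ^ (4 ℕ.* l)) * crossings i j k l
  crossings-suc₁ i j k l = trans
    (*-cong (*-cong (*-cong (*-cong (*-cong (cross-sucˡ i j) (cross-sucˡ i k)) (cross-sucˡ i l)) refl) refl) refl)
    (⊛.solve 9 (λ x y z a b c d e f → (((((x ⊛.⊕ a) ⊛.⊕ (y ⊛.⊕ b)) ⊛.⊕ (z ⊛.⊕ c)) ⊛.⊕ d) ⊛.⊕ e) ⊛.⊕ f
      ⊛.⊜ ((x ⊛.⊕ y) ⊛.⊕ z) ⊛.⊕ (((((a ⊛.⊕ b) ⊛.⊕ c) ⊛.⊕ d) ⊛.⊕ e) ⊛.⊕ f)) refl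
      (q ^ (4 ℕ.* j)) (q ^ (4 ℕ.* k)) (q ^ (4 ℕ.* l))
      (cross i j) (cross i k) (cross i l) (cross j k) (cross j l) (cross k l))

  crossings-suc₂ : ∀ i j k l → crossings i (suc j) k l ≈
    (q ^ (4 ℕ.* i) * q ^ (4 ℕ.* k) * q ^ (4 ℕ.* l)) * crossings i j k l
  crossings-suc₂ i j k l = trans
    (*-cong (*-cong (*-cong (*-cong (*-cong (cross-sucʳ i j) refl) refl) (cross-sucˡ j k)) (cross-sucˡ j l)) refl)
    (⊛.solve 9 (λ x y z a b c d e f → (((((x ⊛.⊕ a) ⊛.⊕ b) ⊛.⊕ c) ⊛.⊕ (y ⊛.⊕ d)) ⊛.⊕ (z ⊛.⊕ e)) ⊛.⊕ f
      ⊛.⊜ ((x ⊛.⊕ y) ⊛.⊕ z) ⊛.⊕ (((((a ⊛.⊕ b) ⊛.⊕ c) ⊛.⊕ d) ⊛.⊕ e) ⊛.⊕ f)) refl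
      (q ^ (4 ℕ.* i)) (q ^ (4 ℕ.* k)) (q ^ (4 ℕ.* l))
      (cross i j) (cross i k) (cross i l) (cross j k) (cross j l) (cross k l))

  crossings-suc₃ : ∀ i j k l → crossings i j (suc k) l ≈
    (q ^ (4 ℕ.* i) * q ^ (4 ℕ.* j) * q ^ (4 ℕ.* l)) * crossings i j k l
  crossings-suc₃ i j k l = trans
    (*-cong (*-cong (*-cong (*-cong (*-cong refl (cross-sucʳ i k)) refl) (cross-sucʳ j k)) refl) (cross-sucˡ k l))
    (⊛.solve 9 (λ x y z a b c d e f → ((((a ⊛.⊕ (x ⊛.⊕ b)) ⊛.⊕ c) ⊛.⊕ (y ⊛.⊕ d)) ⊛.⊕ e) ⊛.⊕ (z ⊛.⊕ f)
      ⊛.⊜ ((x ⊛.⊕ y) ⊛.⊕ z) ⊛.⊕ (((((a ⊛.⊕ b) ⊛.⊕ c) ⊛.⊕ d) ⊛.⊕ e) ⊛.⊕ f)) refl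
      (q ^ (4 ℕ.* i)) (q ^ (4 ℕ.* j)) (q ^ (4 ℕ.* l))
      (cross i j) (cross i k) (cross i l) (cross j k) (cross j l) (cross k l))

  crossings-suc₄ : ∀ i j k l → crossings i j k (suc l) ≈
    (q ^ (4 ℕ.* i) * q ^ (4 ℕ.* j) * q ^ (4 ℕ.* k)) * crossings i j k l
  crossings-suc₄ i j k l = trans
    (*-cong (*-cong (*-cong (*-cong (*-cong refl refl) (cross-sucʳ i l)) refl) (cross-sucʳ j l)) (cross-sucʳ k l))
    (⊛.solve 9 (λ x y z a b c d e f → ((((a ⊛.⊕ b) ⊛.⊕ (x ⊛.⊕ c)) ⊛.⊕ d) ⊛.⊕ (y ⊛.⊕ e)) ⊛.⊕ (z ⊛.⊕ f)
      ⊛.⊜ ((x ⊛.⊕ y) ⊛.⊕ z) ⊛.⊕ (((((a ⊛.⊕ b) ⊛.⊕ c) ⊛.⊕ d) ⊛.⊕ e) ⊛.⊕ f)) refl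
      (q ^ (4 ℕ.* i)) (q ^ (4 ℕ.* j)) (q ^ (4 ℕ.* k))
      (cross i j) (cross i k) (cross i l) (cross j k) (cross j l) (cross k l))

  -- Moves the factor of the index being raised to the front, the position that `expand` and
  -- `*-zero-extract` act on.
  extract₂ : ∀ a b c d x → a * b * c * d * x ≈ b * a * c * d * x
  extract₂ a b c d x = *-congʳ (*-congʳ (*-congʳ (*-comm a b)))

  extract₃ : ∀ a b c d x → a * b * c * d * x ≈ c * a * b * d * x
  extract₃ = ⊛.solve 5 (λ a b c d x → (((a ⊛.⊕ b) ⊛.⊕ c) ⊛.⊕ d) ⊛.⊕ x
                                  ⊛.⊜ (((c ⊛.⊕ a) ⊛.⊕ b) ⊛.⊕ d) ⊛.⊕ x) refl

  extract₄ : ∀ a b c d x → a * b * c * d * x ≈ d * a * b * c * x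
  extract₄ = ⊛.solve 5 (λ a b c d x → (((a ⊛.⊕ b) ⊛.⊕ c) ⊛.⊕ d) ⊛.⊕ x
                                  ⊛.⊜ (((d ⊛.⊕ a) ⊛.⊕ b) ⊛.⊕ c) ⊛.⊕ x) refl

  -- The common core of the four contiguous relations at the level of terms: `a` is the factor of
  -- the raised index, split by `φ-suc`. In the first summand the index stays raised and `x′` is
  -- kept; in the second it drops, so `s`, `t`, `r` are detached from `x′` and absorbed by the
  -- factors of the other indices.
  expand : ∀ {a a′ a″ b b′ c c′ d d′ s t r x x′ u} →
           a ≈ a′ + u * a″ → x′ ≈ (s * t * r) * x → b′ ≈ s * b → c′ ≈ t * c → d′ ≈ r * d →
           a * b * c * d * x′ ≈ a′ * b * c * d * x′ + u * (a″ * b′ * c′ * d′ * x)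
  expand {a} {a′} {a″} {b} {b′} {c} {c′} {d} {d′} {s} {t} {r} {x} {x′} {u} ea ex eb ec ed = begin
    a * b * c * d * x′
      ≈⟨ *-congʳ (*-congʳ (*-congʳ (*-congʳ ea))) ⟩
    (a′ + u * a″) * b * c * d * x′
      ≈⟨ ⊞.solve 7 (λ a u a₂ b c d x → (a ⊞.:+ u ⊞.:* a₂) ⊞.:* b ⊞.:* c ⊞.:* d ⊞.:* x
           ⊞.:= a ⊞.:* b ⊞.:* c ⊞.:* d ⊞.:* x ⊞.:+ u ⊞.:* (a₂ ⊞.:* b ⊞.:* c ⊞.:* d ⊞.:* x))
           refl a′ u a″ b c d x′ ⟩
    a′ * b * c * d * x′ + u * (a″ * b * c * d * x′)
      ≈⟨ +-congˡ (*-congˡ (*-congˡ ex)) ⟩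
    a′ * b * c * d * x′ + u * (a″ * b * c * d * ((s * t * r) * x))
      ≈⟨ +-congˡ (*-congˡ (⊛.solve 8 (λ a b c d s t r x →
           (((a ⊛.⊕ b) ⊛.⊕ c) ⊛.⊕ d) ⊛.⊕ (((s ⊛.⊕ t) ⊛.⊕ r) ⊛.⊕ x)
           ⊛.⊜ (((a ⊛.⊕ (s ⊛.⊕ b)) ⊛.⊕ (t ⊛.⊕ c)) ⊛.⊕ (r ⊛.⊕ d)) ⊛.⊕ x) refl a″ b c d s t r x)) ⟩
    a′ * b * c * d * x′ + u * (a″ * (s * b) * (t * c) * (r * d) * x)
      ≈⟨ +-congˡ (*-congˡ (*-congʳ (*-cong (*-cong (*-congˡ eb) ec) ed))) ⟨
    a′ * b * c * d * x′ + u * (a″ * b′ * c′ * d′ * x) ∎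

  *-zero-extract : ∀ {a b c d x} → a ≈ 0# → a * b * c * d * x ≈ 0#
  *-zero-extract {a} {b} {c} {d} {x} a≈0 = begin
    a * b * c * d * x     ≈⟨ ⊛.solve 5 (λ a b c d x → (((a ⊛.⊕ b) ⊛.⊕ c) ⊛.⊕ d) ⊛.⊕ x
                               ⊛.⊜ a ⊛.⊕ (((b ⊛.⊕ c) ⊛.⊕ d) ⊛.⊕ x)) refl a b c d x ⟩
    a * (b * c * d * x)   ≈⟨ *-congʳ a≈0 ⟩
    0# * (b * c * d * x)  ≈⟨ zeroˡ _ ⟩
    0#                    ∎

  -- The contiguous relations, for terms and then for sums.

  module _ (u₁ u₂ u₃ u₄ : Carrier) where

    T-suc₁ : ∀ i j k l → T u₁ u₂ u₃ u₄ (suc i) j k l ≈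
      T (u₁ * q ^ 2) u₂ u₃ u₄ (suc i) j k l +
      u₁ * T (u₁ * q ^ 4) (u₂ * q ^ 4) (u₃ * q ^ 4) (u₄ * q ^ 4) i j k l
    T-suc₁ i j k l = expand (φ-suc 1 4 u₁ i) (crossings-suc₁ i j k l)
      (φ-*q^ 2 6 u₂ 4 j) (φ-*q^ 4 4 u₃ 4 k) (φ-*q^ 4 8 u₄ 4 l)

    T-suc₂ : ∀ i j k l → T u₁ u₂ u₃ u₄ i (suc j) k l ≈
      T u₁ (u₂ * q ^ 2) u₃ u₄ i (suc j) k l +
      u₂ * T (u₁ * q ^ 4) (u₂ * q ^ 6) (u₃ * q ^ 4) (u₄ * q ^ 4) i j k l
    T-suc₂ i j k l = trans (extract₂ _ _ _ _ _) (trans (expand (φ-suc 1 6 u₂ j) (crossings-suc₂ i j k l)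
      (φ-*q^ 2 4 u₁ 4 i) (φ-*q^ 4 4 u₃ 4 k) (φ-*q^ 4 8 u₄ 4 l))
      (+-cong (sym (extract₂ _ _ _ _ _)) (*-congˡ (sym (extract₂ _ _ _ _ _)))))

    T-suc₃ : ∀ i j k l → T u₁ u₂ u₃ u₄ i j (suc k) l ≈
      T u₁ u₂ (u₃ * q ^ 4) u₄ i j (suc k) l +
      u₃ * T (u₁ * q ^ 4) (u₂ * q ^ 4) (u₃ * q ^ 4) (u₄ * q ^ 4) i j k l
    T-suc₃ i j k l = trans (extract₃ _ _ _ _ _) (trans (expand (φ-suc 3 4 u₃ k) (crossings-suc₃ i j k l)
      (φ-*q^ 2 4 u₁ 4 i) (φ-*q^ 2 6 u₂ 4 j) (φ-*q^ 4 8 u₄ 4 l))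
      (+-cong (sym (extract₃ _ _ _ _ _)) (*-congˡ (sym (extract₃ _ _ _ _ _)))))

    T-suc₄ : ∀ i j k l → T u₁ u₂ u₃ u₄ i j k (suc l) ≈
      T u₁ u₂ u₃ (u₄ * q ^ 4) i j k (suc l) +
      u₄ * T (u₁ * q ^ 4) (u₂ * q ^ 4) (u₃ * q ^ 4) (u₄ * q ^ 8) i j k l
    T-suc₄ i j k l = trans (extract₄ _ _ _ _ _) (trans (expand (φ-suc 3 8 u₄ l) (crossings-suc₄ i j k l)
      (φ-*q^ 2 4 u₁ 4 i) (φ-*q^ 2 6 u₂ 4 j) (φ-*q^ 4 4 u₃ 4 k))
      (+-cong (sym (extract₄ _ _ _ _ _)) (*-congˡ (sym (extract₄ _ _ _ _ _)))))

    -- The boundary condition of `∑-shift`: the term at index `N` contains the `N`-th power of a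
    -- nilpotent weight. This is why truncating the multisum at `N` costs nothing.
    T-small₁ : Small u₁ → ∀ j k l → T u₁ u₂ u₃ u₄ N j k l ≈ 0#
    T-small₁ small _ _ _ = *-zero-extract (φ-small 2 4 small)

    T-small₂ : Small u₂ → ∀ i k l → T u₁ u₂ u₃ u₄ i N k l ≈ 0#
    T-small₂ small _ _ _ = trans (extract₂ _ _ _ _ _) (*-zero-extract (φ-small 2 6 small))

    T-small₃ : Small u₃ → ∀ i j l → T u₁ u₂ u₃ u₄ i j N l ≈ 0#
    T-small₃ small _ _ _ = trans (extract₃ _ _ _ _ _) (*-zero-extract (φ-small 4 4 small))

    T-small₄ : Small u₄ → ∀ i j k → T u₁ u₂ u₃ u₄ i j k N ≈ 0#
    T-small₄ small _ _ _ = trans (extract₄ _ _ _ _ _) (*-zero-extract (φ-small 4 8 small))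

  opaque
    unfolding H

    H-rec₁ : ∀ {u₁ u₂ u₃ u₄} → Small u₁ → H u₁ u₂ u₃ u₄ ≈
      H (u₁ * q ^ 2) u₂ u₃ u₄ + u₁ * H (u₁ * q ^ 4) (u₂ * q ^ 4) (u₃ * q ^ 4) (u₄ * q ^ 4)
    H-rec₁ small = trans (∑⁴-shift₁ N
      (T-small₁ _ _ _ _ small) (T-small₁ _ _ _ _ (small-*ˡ _ small))
      -- At index 0 the weight enters through its zeroth power, so rescaling it changes nothing and
      -- both terms are definitionally equal.
      (λ _ _ _ → refl) (T-suc₁ _ _ _ _))
      (+-congˡ (sym (*-distribˡ-∑⁴ N _ _)))

    H-rec₂ : ∀ {u₁ u₂ u₃ u₄} → Small u₂ → H u₁ u₂ u₃ u₄ ≈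
      H u₁ (u₂ * q ^ 2) u₃ u₄ + u₂ * H (u₁ * q ^ 4) (u₂ * q ^ 6) (u₃ * q ^ 4) (u₄ * q ^ 4)
    H-rec₂ small = trans (∑⁴-shift₂ N
      (T-small₂ _ _ _ _ small) (T-small₂ _ _ _ _ (small-*ˡ _ small))
      (λ _ _ _ → refl) (T-suc₂ _ _ _ _))
      (+-congˡ (sym (*-distribˡ-∑⁴ N _ _)))

    H-rec₃ : ∀ {u₁ u₂ u₃ u₄} → Small u₃ → H u₁ u₂ u₃ u₄ ≈
      H u₁ u₂ (u₃ * q ^ 4) u₄ + u₃ * H (u₁ * q ^ 4) (u₂ * q ^ 4) (u₃ * q ^ 4) (u₄ * q ^ 4)
    H-rec₃ small = trans (∑⁴-shift₃ N
      (T-small₃ _ _ _ _ small) (T-small₃ _ _ _ _ (small-*ˡ _ small))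
      (λ _ _ _ → refl) (T-suc₃ _ _ _ _))
      (+-congˡ (sym (*-distribˡ-∑⁴ N _ _)))

    H-rec₄ : ∀ {u₁ u₂ u₃ u₄} → Small u₄ → H u₁ u₂ u₃ u₄ ≈
      H u₁ u₂ u₃ (u₄ * q ^ 4) + u₄ * H (u₁ * q ^ 4) (u₂ * q ^ 4) (u₃ * q ^ 4) (u₄ * q ^ 8)
    H-rec₄ small = trans (∑⁴-shift₄ N
      (T-small₄ _ _ _ _ small) (T-small₄ _ _ _ _ (small-*ˡ _ small))
      (λ _ _ _ → refl) (T-suc₄ _ _ _ _))
      (+-congˡ (sym (*-distribˡ-∑⁴ N _ _)))

  -- The functional equation of R under x ↦ xq².

  R : (x y : Carrier) → Carrier
  R x y = H (x * q ^ 1) (x * y * q ^ 3) (y * q ^ 2) (x ^ 2 * q ^ 4) +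
          x ^ 2 * y * q ^ 6 *
          H (x * q ^ 1 * q ^ 8) (x * y * q ^ 3 * q ^ 8) (y * q ^ 2 * q ^ 8) (x ^ 2 * q ^ 4 * q ^ 8)

  R-cong : ∀ {x x′ y} → x ≈ x′ → R x y ≈ R x′ y
  R-cong x≈x′ = +-cong
    (H-cong (*-congʳ x≈x′) (*-congʳ (*-congʳ x≈x′)) refl (*-congʳ (^-congˡ 2 x≈x′)))
    (*-cong (*-congʳ (*-congʳ (^-congˡ 2 x≈x′)))
      (H-cong (*-congʳ (*-congʳ x≈x′)) (*-congʳ (*-congʳ (*-congʳ x≈x′))) refl
              (*-congʳ (*-congʳ (^-congˡ 2 x≈x′)))))

  *-q^-merge : ∀ u k l → u * q ^ k * q ^ l ≈ u * q ^ (k ℕ.+ l)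
  *-q^-merge u k l = trans (*-assoc _ _ _) (*-congˡ (sym (^-homo-* q k l)))

  private
    -- The polynomial identity left once all contiguous relations are applied: both sides are linear
    -- in the values `h₀`, ..., `h₅` of H, with equal coefficients. These values are variables here,
    -- so the solver sees only polynomials.
    collect : ∀ x y q h₀ h₁ h₂ h₃ h₄ h₅ →
      h₀ + x ^ 2 * q ^ 4 * q ^ 0 * (h₁ + y * q ^ 2 * q ^ 4 * h₄)
        + x * y * q ^ 3 * q ^ 0 * (h₂ + x ^ 2 * q ^ 4 * q ^ 4 * h₄)
        + x * q ^ 1 * q ^ 0 * h₃ + x ^ 2 * y * q ^ 6 * h₅ ≈
      h₀ + (x * q ^ 2) ^ 2 * y * q ^ 6 * h₄ + x * q ^ 1 *
        (h₃ + x * y * q ^ 3 * q ^ 2 * h₅ + x * q ^ 1 * q ^ 2 * h₁ + y * q ^ 2 * q ^ 0 * h₂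
          + (x * q ^ 2) ^ 2 * y * q ^ 6 * h₄)
    collect = solve 9 (λ x y q h₀ h₁ h₂ h₃ h₄ h₅ →
      h₀ :+ x :^ 2 :* q :^ 4 :* q :^ 0 :* (h₁ :+ y :* q :^ 2 :* q :^ 4 :* h₄)
        :+ x :* y :* q :^ 3 :* q :^ 0 :* (h₂ :+ x :^ 2 :* q :^ 4 :* q :^ 4 :* h₄)
        :+ x :* q :^ 1 :* q :^ 0 :* h₃ :+ x :^ 2 :* y :* q :^ 6 :* h₅
      := h₀ :+ (x :* q :^ 2) :^ 2 :* y :* q :^ 6 :* h₄ :+ x :* q :^ 1 :*
        (h₃ :+ x :* y :* q :^ 3 :* q :^ 2 :* h₅ :+ x :* q :^ 1 :* q :^ 2 :* h₁
          :+ y :* q :^ 2 :* q :^ 0 :* h₂ :+ (x :* q :^ 2) :^ 2 :* y :* q :^ 6 :* h₄)) refl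
      where open SemiringSolver K

  module _ (x y : Carrier) where
    private
      u₁ = x * q ^ 1
      u₂ = x * y * q ^ 3
      u₃ = y * q ^ 2
      u₄ = x ^ 2 * q ^ 4

      -- The multiples of the weights that occur under x ↦ xq² and under the contiguous relations.
      h : (a b c d : ℕ) → Carrier
      h a b c d = H (u₁ * q ^ a) (u₂ * q ^ b) (u₃ * q ^ c) (u₄ * q ^ d)

      merge : ∀ {a b c d} a′ b′ c′ d′ →
        H (u₁ * q ^ a * q ^ a′) (u₂ * q ^ b * q ^ b′) (u₃ * q ^ c * q ^ c′) (u₄ * q ^ d * q ^ d′) ≈
        h (a ℕ.+ a′) (b ℕ.+ b′) (c ℕ.+ c′) (d ℕ.+ d′)
      merge {a} {b} {c} {d} a′ b′ c′ d′ =
        H-cong (*-q^-merge u₁ a a′) (*-q^-merge u₂ b b′) (*-q^-merge u₃ c c′) (*-q^-merge u₄ d d′)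

      h-rec₁ : ∀ a b c d → h a b c d ≈ h (a ℕ.+ 2) b c d +
               u₁ * q ^ a * h (a ℕ.+ 4) (b ℕ.+ 4) (c ℕ.+ 4) (d ℕ.+ 4)
      h-rec₁ a b c d = trans (H-rec₁ (small-*ˡ (q ^ a) (small-*q^ x 0)))
        (+-cong (H-cong (*-q^-merge u₁ a 2) refl refl refl) (*-congˡ (merge {a} {b} {c} {d} 4 4 4 4)))

      h-rec₂ : ∀ a b c d → h a b c d ≈ h a (b ℕ.+ 2) c d +
               u₂ * q ^ b * h (a ℕ.+ 4) (b ℕ.+ 6) (c ℕ.+ 4) (d ℕ.+ 4)
      h-rec₂ a b c d = trans (H-rec₂ (small-*ˡ (q ^ b) (small-*q^ (x * y) 2)))
        (+-cong (H-cong refl (*-q^-merge u₂ b 2) refl refl) (*-congˡ (merge {a} {b} {c} {d} 4 6 4 4)))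

      h-rec₃ : ∀ a b c d → h a b c d ≈ h a b (c ℕ.+ 4) d +
               u₃ * q ^ c * h (a ℕ.+ 4) (b ℕ.+ 4) (c ℕ.+ 4) (d ℕ.+ 4)
      h-rec₃ a b c d = trans (H-rec₃ (small-*ˡ (q ^ c) (small-*q^ y 1)))
        (+-cong (H-cong refl refl (*-q^-merge u₃ c 4) refl) (*-congˡ (merge {a} {b} {c} {d} 4 4 4 4)))

      h-rec₄ : ∀ a b c d → h a b c d ≈ h a b c (d ℕ.+ 4) +
               u₄ * q ^ d * h (a ℕ.+ 4) (b ℕ.+ 4) (c ℕ.+ 4) (d ℕ.+ 8)
      h-rec₄ a b c d = trans (H-rec₄ (small-*ˡ (q ^ d) (small-*q^ (x ^ 2) 3)))
        (+-cong (H-cong refl refl refl (*-q^-merge u₄ d 4)) (*-congˡ (merge {a} {b} {c} {d} 4 4 4 8)))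

      -- The substitution x ↦ xq² multiplies the weights by q², q², 1, q⁴. One use each of the
      -- first, second and fourth relations therefore leads to `h 2 2 0 4`, the leading part of
      -- R(xq²,y).
      h-expand₀ : h 0 0 0 0 ≈ h 2 2 0 4 + u₄ * q ^ 0 * h 6 6 4 8 + u₂ * q ^ 0 * h 6 6 4 4
                              + u₁ * q ^ 0 * h 4 4 4 4
      h-expand₀ = trans (h-rec₁ 0 0 0 0) (+-congʳ
                 (trans (h-rec₂ 2 0 0 0) (+-congʳ
                        (h-rec₄ 2 2 0 0))))

      -- Meant for the copy of `h 2 2 0 4` that is multiplied by xq in (1 + xq) R(xq²,y). The path
      -- is chosen to end at `h 4 4 4 4`, the remainder of the first relation in `h-expand₀`, and to
      -- meet `h 8 8 8 8`, the second part of R(x,y).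
      h-expand₁ : h 2 2 0 4 ≈ h 4 4 4 4 + u₂ * q ^ 2 * h 8 8 8 8 + u₁ * q ^ 2 * h 6 6 8 8
                              + u₃ * q ^ 0 * h 6 6 4 8
      h-expand₁ = trans (h-rec₃ 2 2 0 4) (+-congʳ
                 (trans (h-rec₁ 2 2 4 4) (+-congʳ
                        (h-rec₂ 4 2 4 4))))

      R≈h : R x y ≈ h 0 0 0 0 + x ^ 2 * y * q ^ 6 * h 8 8 8 8
      R≈h = +-congʳ (sym (H-cong (*-identityʳ _) (*-identityʳ _) (*-identityʳ _) (*-identityʳ _)))

      R-*q²≈h : R (x * q ^ 2) y ≈ h 2 2 0 4 + (x * q ^ 2) ^ 2 * y * q ^ 6 * h 10 10 8 12
      R-*q²≈h = +-cong
        (H-cong e₁ e₂ (sym (*-identityʳ _)) e₄)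
        (*-congˡ (H-cong
          (trans (*-congʳ e₁) (*-q^-merge u₁ 2 8)) (trans (*-congʳ e₂) (*-q^-merge u₂ 2 8))
          refl (trans (*-congʳ e₄) (*-q^-merge u₄ 4 8))))
        where
        open SemiringSolver K
        e₁ = solve 2 (λ x q → x :* q :^ 2 :* q :^ 1 := x :* q :^ 1 :* q :^ 2) refl x q
        e₂ = solve 3 (λ x y q → x :* q :^ 2 :* y :* q :^ 3 := x :* y :* q :^ 3 :* q :^ 2) refl x y q
        e₄ = solve 2 (λ x q → (x :* q :^ 2) :^ 2 :* q :^ 4 := x :^ 2 :* q :^ 4 :* q :^ 4) refl x q

    R-rec : R x y ≈ (1# + x * q ^ 1) * R (x * q ^ 2) y
    R-rec = begin
      R x y
        ≈⟨ R≈h ⟩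
      h 0 0 0 0 + w * h 8 8 8 8
        ≈⟨ +-congʳ h-expand₀ ⟩
      h 2 2 0 4 + u₄ * q ^ 0 * h 6 6 4 8 + u₂ * q ^ 0 * h 6 6 4 4 + u₁ * q ^ 0 * h 4 4 4 4 + w * h 8 8 8 8
        -- Both relations leave the remainder `h 10 10 8 12`, which is the second H-value of
        -- R(xq²,y); their main terms `h 6 6 8 8` and `h 6 6 4 8` are the ones that occur in
        -- `h-expand₁`.
        ≈⟨ +-congʳ (+-congʳ (+-cong (+-congˡ (*-congˡ (h-rec₃ 6 6 4 8))) (*-congˡ (h-rec₄ 6 6 4 4)))) ⟩
      h 2 2 0 4 + u₄ * q ^ 0 * (h 6 6 8 8 + u₃ * q ^ 4 * h 10 10 8 12)
        + u₂ * q ^ 0 * (h 6 6 4 8 + u₄ * q ^ 4 * h 10 10 8 12) + u₁ * q ^ 0 * h 4 4 4 4 + w * h 8 8 8 8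
        ≈⟨ collect x y q (h 2 2 0 4) (h 6 6 8 8) (h 6 6 4 8) (h 4 4 4 4) (h 10 10 8 12) (h 8 8 8 8) ⟩
      h 2 2 0 4 + z + u₁ * (h 4 4 4 4 + u₂ * q ^ 2 * h 8 8 8 8 + u₁ * q ^ 2 * h 6 6 8 8
        + u₃ * q ^ 0 * h 6 6 4 8 + z)
        -- Only the copy under the factor `u₁` is folded back; the other copy of `h 2 2 0 4` was
        -- never expanded.
        ≈⟨ +-congˡ (*-congˡ (+-congʳ h-expand₁)) ⟨
      h 2 2 0 4 + z + u₁ * (h 2 2 0 4 + z)
        ≈⟨ solve 2 (λ u a → a :+ u :* a := (con 1 :+ u) :* a) refl u₁ (h 2 2 0 4 + z) ⟩
      (1# + u₁) * (h 2 2 0 4 + z)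
        ≈⟨ *-congˡ R-*q²≈h ⟨
      (1# + u₁) * R (x * q ^ 2) y ∎
      where
      open SemiringSolver K
      w = x ^ 2 * y * q ^ 6
      z = (x * q ^ 2) ^ 2 * y * q ^ 6 * h 10 10 8 12

  -- Iteration of the functional equation down to the two products.

  q^≈0 : ∀ k → q ^ (k ℕ.+ N) ≈ 0#
  q^≈0 k = trans (^-homo-* q k N) (trans (*-congˡ q^N≈0) (zeroʳ _))

  R-iterate : ∀ x y n → R x y ≈ ∏ n (λ k → 1# + x * q ^ (2 ℕ.* k ℕ.+ 1)) * R (x * q ^ (2 ℕ.* n)) y
  R-iterate x y zero = sym (trans (*-identityˡ _) (R-cong (*-identityʳ x)))
  R-iterate x y (suc n) = begin
    R x y
      ≈⟨ R-iterate x y n ⟩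
    P * R (x * q ^ (2 ℕ.* n)) y
      ≈⟨ *-congˡ (R-rec (x * q ^ (2 ℕ.* n)) y) ⟩
    P * ((1# + x * q ^ (2 ℕ.* n) * q ^ 1) * R (x * q ^ (2 ℕ.* n) * q ^ 2) y)
      ≈⟨ *-congˡ (*-cong (+-congˡ (*-q^-merge x (2 ℕ.* n) 1))
           (R-cong (trans (*-q^-merge x (2 ℕ.* n) 2) (*-congˡ (^-congʳ q (eq n)))))) ⟩
    P * ((1# + x * q ^ (2 ℕ.* n ℕ.+ 1)) * R (x * q ^ (2 ℕ.* suc n)) y)
      ≈⟨ *-assoc _ _ _ ⟨
    P * (1# + x * q ^ (2 ℕ.* n ℕ.+ 1)) * R (x * q ^ (2 ℕ.* suc n)) y ∎
    where
    P = ∏ n (λ k → 1# + x * q ^ (2 ℕ.* k ℕ.+ 1))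
    eq : ∀ n → 2 ℕ.* n ℕ.+ 2 ≡ 2 ℕ.* suc n
    eq = solve-∀

  -- The value of R at x = 0 (see R-zero), an Euler sum in y alone.
  J : Carrier → Carrier
  J v = H 0# 0# v 0#

  J-cong : ∀ {v v′} → v ≈ v′ → J v ≈ J v′
  J-cong v≈v′ = H-cong refl refl v≈v′ refl

  -- The third contiguous relation with the other weights 0: multiplication by q⁴ fixes 0, so both
  -- terms on the right contain the same value of `J` and the relation factors.
  J-rec : ∀ {v} → Small v → J v ≈ (1# + v) * J (v * q ^ 4)
  J-rec {v} small = begin
    J v
      ≈⟨ H-rec₃ small ⟩
    J (v * q ^ 4) + v * H (0# * q ^ 4) (0# * q ^ 4) (v * q ^ 4) (0# * q ^ 4)
      ≈⟨ +-cong (sym (*-identityˡ _)) (*-congˡ (H-cong (zeroˡ _) (zeroˡ _) refl (zeroˡ _))) ⟩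
    1# * J (v * q ^ 4) + v * J (v * q ^ 4)
      ≈⟨ distribʳ _ 1# v ⟨
    (1# + v) * J (v * q ^ 4) ∎

  J-iterate : ∀ y n → J (y * q ^ 2) ≈
              ∏ n (λ k → 1# + y * q ^ (4 ℕ.* k ℕ.+ 2)) * J (y * q ^ (4 ℕ.* n ℕ.+ 2))
  J-iterate y zero = sym (*-identityˡ _)
  J-iterate y (suc n) = begin
    J (y * q ^ 2)
      ≈⟨ J-iterate y n ⟩
    P * J v
      ≈⟨ *-congˡ (J-rec (trans (^-congˡ N (*-congˡ (^-congʳ q (eq₁ n)))) (small-*q^ y (4 ℕ.* n ℕ.+ 1)))) ⟩
    P * ((1# + v) * J (v * q ^ 4))
      ≈⟨ *-assoc _ _ _ ⟨
    P * (1# + v) * J (v * q ^ 4)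
      ≈⟨ *-congˡ (J-cong (trans (*-q^-merge y (4 ℕ.* n ℕ.+ 2) 4) (*-congˡ (^-congʳ q (eq₂ n))))) ⟩
    P * (1# + v) * J (y * q ^ (4 ℕ.* suc n ℕ.+ 2)) ∎
    where
    P = ∏ n (λ k → 1# + y * q ^ (4 ℕ.* k ℕ.+ 2))
    v = y * q ^ (4 ℕ.* n ℕ.+ 2)
    eq₁ : ∀ n → 4 ℕ.* n ℕ.+ 2 ≡ suc (4 ℕ.* n ℕ.+ 1)
    eq₁ = solve-∀
    eq₂ : ∀ n → 4 ℕ.* n ℕ.+ 2 ℕ.+ 4 ≡ 4 ℕ.* suc n ℕ.+ 2
    eq₂ = solve-∀

  -- A zero weight kills every term in which its index is positive, leaving the term with all
  -- indices 0. That term is within range because `N` is a successor.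
  J-zero : J 0# ≈ 1#
  J-zero = begin
    J 0#
      ≡⟨ H-unfold ⟩
    ∑⁴ N (T 0# 0# 0# 0#)
      ≈⟨ ∑-head M (λ i → ∑-zero N λ j → ∑-zero N λ k → ∑-zero N λ l → *-zero-extract (φ-zero 2 4 i)) ⟩
    _ ≈⟨ ∑-head M (λ j → ∑-zero N λ k → ∑-zero N λ l → trans (extract₂ _ _ _ _ _) (*-zero-extract (φ-zero 2 6 j))) ⟩
    _ ≈⟨ ∑-head M (λ k → ∑-zero N λ l → trans (extract₃ _ _ _ _ _) (*-zero-extract (φ-zero 4 4 k))) ⟩
    _ ≈⟨ ∑-head M (λ l → trans (extract₄ _ _ _ _ _) (*-zero-extract (φ-zero 4 8 l))) ⟩
    T 0# 0# 0# 0# 0 0 0 0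
      ≈⟨ *-cong (*-cong (*-cong (*-cong (φ-0 2 4) (φ-0 2 6)) (φ-0 4 4)) (φ-0 4 8)) refl ⟩
    1# * 1# * 1# * 1# * (1# * 1# * 1# * 1# * 1# * 1#)
      ≈⟨ ⊛.solve 0 (((((⊛.id ⊛.⊕ ⊛.id) ⊛.⊕ ⊛.id) ⊛.⊕ ⊛.id) ⊛.⊕
           (((((⊛.id ⊛.⊕ ⊛.id) ⊛.⊕ ⊛.id) ⊛.⊕ ⊛.id) ⊛.⊕ ⊛.id) ⊛.⊕ ⊛.id)) ⊛.⊜ ⊛.id) refl ⟩
    1# ∎
    where
    φ-zero : ∀ s c n → φ s c 0# (suc n) ≈ 0#
    φ-zero s c n = trans (*-congʳ (zeroˡ _)) (zeroˡ _)
    φ-0 : ∀ s c → φ s c 0# 0 ≈ 1#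
    φ-0 s c = trans (*-identityˡ _) (trans (*-identityʳ _) (^-congʳ q {c ℕ.* (0 C 2)} {0} (ℕ.*-zeroʳ c)))

  -- After `N` iterations the arguments x q^(2N) and y q^(4N+2) are 0, since their powers of q are
  -- at least the `N`-th. This replaces the limit of the usual infinite iteration; the chain runs
  -- from the products back to R.
  R-product : ∀ x y → ∏ N (λ k → 1# + x * q ^ (2 ℕ.* k ℕ.+ 1)) *
                      ∏ N (λ k → 1# + y * q ^ (4 ℕ.* k ℕ.+ 2)) ≈ R x y
  R-product x y = begin
    P * P′                              ≈⟨ *-congˡ (*-identityʳ P′) ⟨
    P * (P′ * 1#)                       ≈⟨ *-congˡ (*-congˡ J-zero) ⟨
    P * (P′ * J 0#)                     ≈⟨ *-congˡ (*-congˡ (J-cong (q^-vanish y (3 ℕ.* M ℕ.+ 5) (eq₄ M)))) ⟨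
    P * (P′ * J (y * q ^ (4 ℕ.* N ℕ.+ 2))) ≈⟨ *-congˡ (J-iterate y N) ⟨
    P * J (y * q ^ 2)                   ≈⟨ *-congˡ R-zero ⟨
    P * R 0# y                          ≈⟨ *-congˡ (R-cong (q^-vanish x N (eq₂ M))) ⟨
    P * R (x * q ^ (2 ℕ.* N)) y         ≈⟨ R-iterate x y N ⟨
    R x y                               ∎
    where
    P = ∏ N (λ k → 1# + x * q ^ (2 ℕ.* k ℕ.+ 1))
    P′ = ∏ N (λ k → 1# + y * q ^ (4 ℕ.* k ℕ.+ 2))
    q^-vanish : ∀ v l {k} → k ≡ l ℕ.+ N → v * q ^ k ≈ 0#
    q^-vanish v l ≡.refl = trans (*-congˡ (q^≈0 l)) (zeroʳ v)
    eq₂ : ∀ n → 2 ℕ.* suc n ≡ suc n ℕ.+ suc n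
    eq₂ = solve-∀
    eq₄ : ∀ n → 4 ℕ.* suc n ℕ.+ 2 ≡ (3 ℕ.* n ℕ.+ 5) ℕ.+ suc n
    eq₄ = solve-∀
    R-zero : R 0# y ≈ J (y * q ^ 2)
    R-zero = trans
      (+-cong (H-cong (zeroˡ _) (trans (*-congʳ (zeroˡ y)) (zeroˡ _)) refl (trans (*-congʳ (zeroˡ _)) (zeroˡ _)))
        (trans (*-congʳ (trans (*-congʳ (trans (*-congʳ (zeroˡ _)) (zeroˡ y))) (zeroˡ _))) (zeroˡ _)))
      (+-identityʳ _)

  -- The exponents of a factorisation, recorded in an index because unification cannot read
  -- them off w ^ m.
  data Power (w : Carrier) : ℕ → Carrier → Set where
    pow : ∀ m → Power w m (w ^ m)
    _⊹_ : ∀ {m n a b} → Power w m a → Power w n b → Power w (m ℕ.+ n) (a * b)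

  infixl 6 _⊹_

  ^-split : ∀ {w m a} → Power w m a → w ^ m ≈ a
  ^-split (pow m) = refl
  ^-split {w} (_⊹_ {m} {n} s t) = trans (^-homo-* w m n) (*-cong (^-split s) (^-split t))

  -- Matching R with the summand of the theorem.

  module _ (x y : Carrier) where

    -- Copies the shape of `rhsTerm` factor by factor, so that the passage from series to the
    -- semiring is by congruence alone.
    summand : ℕ → ℕ → ℕ → ℕ → Carrier
    summand i j k l =
      x ^ (i ℕ.+ j ℕ.+ 2 ℕ.* l) *
      (y ^ (j ℕ.+ k) * q ^ (i ℕ.+ 3 ℕ.* j ℕ.+ 2 ℕ.* k ℕ.+ 4 ℕ.* l ℕ.+ E)) *
      (1# + x ^ 2 * (y ^ 1 * q ^ (6 ℕ.+ 8 ℕ.* (i ℕ.+ j ℕ.+ k ℕ.+ l)))) *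
      invPochhammer 2 i * invPochhammer 2 j * invPochhammer 4 k * invPochhammer 4 l
      where
      E : ℕ
      E = 4 ℕ.* (i C 2) ℕ.+ 6 ℕ.* (j C 2) ℕ.+ 4 ℕ.* (k C 2) ℕ.+ 8 ℕ.* (l C 2)
          ℕ.+ 4 ℕ.* i ℕ.* j ℕ.+ 4 ℕ.* i ℕ.* k ℕ.+ 4 ℕ.* i ℕ.* l
          ℕ.+ 4 ℕ.* j ℕ.* k ℕ.+ 4 ℕ.* j ℕ.* l ℕ.+ 4 ℕ.* k ℕ.* l

    private
      u₁ = x * q ^ 1
      u₂ = x * y * q ^ 3
      u₃ = y * q ^ 2
      u₄ = x ^ 2 * q ^ 4

      -- Accounts for the part of 1 + x²y⋯ that depends on the indices: multiplying every weight by
      -- q⁸ contributes q⁸ once per unit of each index.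
      T-*q⁸ : ∀ i j k l →
        T (u₁ * q ^ 8) (u₂ * q ^ 8) (u₃ * q ^ 8) (u₄ * q ^ 8) i j k l ≈
        q ^ (8 ℕ.* (i ℕ.+ j ℕ.+ k ℕ.+ l)) * T u₁ u₂ u₃ u₄ i j k l
      T-*q⁸ i j k l = begin
        T (u₁ * q ^ 8) (u₂ * q ^ 8) (u₃ * q ^ 8) (u₄ * q ^ 8) i j k l
          ≈⟨ *-congʳ (*-cong (*-cong (*-cong (φ-*q^ 2 4 u₁ 8 i) (φ-*q^ 2 6 u₂ 8 j)) (φ-*q^ 4 4 u₃ 8 k))
               (φ-*q^ 4 8 u₄ 8 l)) ⟩
        q ^ (8 ℕ.* i) * φ 2 4 u₁ i * (q ^ (8 ℕ.* j) * φ 2 6 u₂ j) * (q ^ (8 ℕ.* k) * φ 4 4 u₃ k)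
          * (q ^ (8 ℕ.* l) * φ 4 8 u₄ l) * crossings i j k l
          ≈⟨ ⊛.solve 9 (λ p q r s a b c d x →
               ((((p ⊛.⊕ a) ⊛.⊕ (q ⊛.⊕ b)) ⊛.⊕ (r ⊛.⊕ c)) ⊛.⊕ (s ⊛.⊕ d)) ⊛.⊕ x
               ⊛.⊜ (((p ⊛.⊕ q) ⊛.⊕ r) ⊛.⊕ s) ⊛.⊕ ((((a ⊛.⊕ b) ⊛.⊕ c) ⊛.⊕ d) ⊛.⊕ x)) refl
               (q ^ (8 ℕ.* i)) (q ^ (8 ℕ.* j)) (q ^ (8 ℕ.* k)) (q ^ (8 ℕ.* l))
               (φ 2 4 u₁ i) (φ 2 6 u₂ j) (φ 4 4 u₃ k) (φ 4 8 u₄ l) (crossings i j k l) ⟩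
        q ^ (8 ℕ.* i) * q ^ (8 ℕ.* j) * q ^ (8 ℕ.* k) * q ^ (8 ℕ.* l) * T u₁ u₂ u₃ u₄ i j k l
          ≈⟨ *-congʳ (trans (^-congʳ q (eq i j k l))
               (^-split (pow (8 ℕ.* i) ⊹ pow (8 ℕ.* j) ⊹ pow (8 ℕ.* k) ⊹ pow (8 ℕ.* l)))) ⟨
        q ^ (8 ℕ.* (i ℕ.+ j ℕ.+ k ℕ.+ l)) * T u₁ u₂ u₃ u₄ i j k l ∎
        where
        eq : ∀ i j k l → 8 ℕ.* (i ℕ.+ j ℕ.+ k ℕ.+ l) ≡ 8 ℕ.* i ℕ.+ 8 ℕ.* j ℕ.+ 8 ℕ.* k ℕ.+ 8 ℕ.* l
        eq = solve-∀

      *q^-^ : ∀ v k n → (v * q ^ k) ^ n ≈ v ^ n * q ^ (k ℕ.* n)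
      *q^-^ v k n = trans (^-distrib-* v (q ^ k) n) (*-congˡ (^-assocʳ q k n))

      -- Substituting the weights and merging powers of x, y and q gives the exponents of the
      -- theorem. The variable `z` holds the place of the factor 1 + x²y⋯, which `T-split`
      -- distributes.
      T-as-summand : ∀ i j k l z → T u₁ u₂ u₃ u₄ i j k l * z ≈
        x ^ (i ℕ.+ j ℕ.+ 2 ℕ.* l) *
        (y ^ (j ℕ.+ k) * q ^ (i ℕ.+ 3 ℕ.* j ℕ.+ 2 ℕ.* k ℕ.+ 4 ℕ.* l ℕ.+
          (4 ℕ.* (i C 2) ℕ.+ 6 ℕ.* (j C 2) ℕ.+ 4 ℕ.* (k C 2) ℕ.+ 8 ℕ.* (l C 2)
          ℕ.+ 4 ℕ.* i ℕ.* j ℕ.+ 4 ℕ.* i ℕ.* k ℕ.+ 4 ℕ.* i ℕ.* l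
          ℕ.+ 4 ℕ.* j ℕ.* k ℕ.+ 4 ℕ.* j ℕ.* l ℕ.+ 4 ℕ.* k ℕ.* l))) *
        z * invPochhammer 2 i * invPochhammer 2 j * invPochhammer 4 k * invPochhammer 4 l
      T-as-summand i j k l z = trans
        (*-congʳ (*-congʳ (*-cong (*-cong (*-cong
          (*-congʳ (trans (*q^-^ x 1 i) (*-congˡ (^-congʳ q (ℕ.*-identityˡ i)))))
          (*-congʳ (trans (*q^-^ (x * y) 3 j) (*-congʳ (^-distrib-* x y j)))))
          (*-congʳ (*q^-^ y 2 k)))
          (*-congʳ (trans (*q^-^ (x ^ 2) 4 l) (*-congʳ (^-assocʳ x 2 l)))))))
        (trans
        (⊛.solve 24 (λ xi xj xl yj yk qi qj qk ql a b c d e f g h m n A B D F z →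
          ((((((xi ⊛.⊕ qi) ⊛.⊕ (a ⊛.⊕ A)) ⊛.⊕ (((xj ⊛.⊕ yj) ⊛.⊕ qj) ⊛.⊕ (b ⊛.⊕ B)))
            ⊛.⊕ ((yk ⊛.⊕ qk) ⊛.⊕ (c ⊛.⊕ D))) ⊛.⊕ ((xl ⊛.⊕ ql) ⊛.⊕ (d ⊛.⊕ F)))
          
            ⊛.⊕ (((((e ⊛.⊕ f) ⊛.⊕ g) ⊛.⊕ h) ⊛.⊕ m) ⊛.⊕ n)) ⊛.⊕ z
          ⊛.⊜ (((((((xi ⊛.⊕ xj) ⊛.⊕ xl) ⊛.⊕ ((yj ⊛.⊕ yk)
            ⊛.⊕ ((((qi ⊛.⊕ qj) ⊛.⊕ qk) ⊛.⊕ ql)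
            ⊛.⊕ (((((((((a ⊛.⊕ b) ⊛.⊕ c) ⊛.⊕ d) ⊛.⊕ e) ⊛.⊕ f) ⊛.⊕ g) ⊛.⊕ h) ⊛.⊕ m) ⊛.⊕ n)))) ⊛.⊕ z) ⊛.⊕ A) ⊛.⊕ B) ⊛.⊕ D) ⊛.⊕ F) refl
          (x ^ i) (x ^ j) (x ^ (2 ℕ.* l)) (y ^ j) (y ^ k) (q ^ i) (q ^ (3 ℕ.* j)) (q ^ (2 ℕ.* k)) (q ^ (4 ℕ.* l))
          (q ^ (4 ℕ.* (i C 2))) (q ^ (6 ℕ.* (j C 2))) (q ^ (4 ℕ.* (k C 2))) (q ^ (8 ℕ.* (l C 2)))
          (cross i j) (cross i k) (cross i l) (cross j k) (cross j l) (cross k l)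
          (invPochhammer 2 i) (invPochhammer 2 j) (invPochhammer 4 k) (invPochhammer 4 l) z)
        (*-congʳ (*-congʳ (*-congʳ (*-congʳ (*-congʳ (sym (*-cong
          (^-split (pow i ⊹ pow j ⊹ pow (2 ℕ.* l)))
          (*-cong (^-split (pow j ⊹ pow k))
            (^-split (pow i ⊹ pow (3 ℕ.* j) ⊹ pow (2 ℕ.* k) ⊹ pow (4 ℕ.* l) ⊹
              (pow (4 ℕ.* (i C 2)) ⊹ pow (6 ℕ.* (j C 2)) ⊹ pow (4 ℕ.* (k C 2)) ⊹ pow (8 ℕ.* (l C 2))
               ⊹ pow (4 ℕ.* i ℕ.* j) ⊹ pow (4 ℕ.* i ℕ.* k) ⊹ pow (4 ℕ.* i ℕ.* l)
               ⊹ pow (4 ℕ.* j ℕ.* k) ⊹ pow (4 ℕ.* j ℕ.* l) ⊹ pow (4 ℕ.* k ℕ.* l)))))))))))))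

      T₀ = T u₁ u₂ u₃ u₄
      T₈ = T (u₁ * q ^ 8) (u₂ * q ^ 8) (u₃ * q ^ 8) (u₄ * q ^ 8)
      c = x ^ 2 * y * q ^ 6

      T-split : ∀ i j k l →
        T₀ i j k l * (1# + x ^ 2 * (y ^ 1 * q ^ (6 ℕ.+ 8 ℕ.* (i ℕ.+ j ℕ.+ k ℕ.+ l)))) ≈
        T₀ i j k l + c * T₈ i j k l
      T-split i j k l = begin
        t * (1# + x ^ 2 * (y ^ 1 * q ^ (6 ℕ.+ m)))
          ≈⟨ *-congˡ (+-congˡ (*-congˡ (*-cong (*-identityʳ y) (^-homo-* q 6 m)))) ⟩
        t * (1# + x ^ 2 * (y * (q ^ 6 * q ^ m)))
          ≈⟨ ⊞.solve 5 (λ t x y r s → t ⊞.:* (⊞.con 1 ⊞.:+ x ⊞.:* (y ⊞.:* (r ⊞.:* s)))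
               ⊞.:= t ⊞.:+ x ⊞.:* y ⊞.:* r ⊞.:* (s ⊞.:* t)) refl t (x ^ 2) y (q ^ 6) (q ^ m) ⟩
        t + c * (q ^ m * t)
          ≈⟨ +-congˡ (*-congˡ (T-*q⁸ i j k l)) ⟨
        t + c * T₈ i j k l ∎
        where
        t = T₀ i j k l
        m = 8 ℕ.* (i ℕ.+ j ℕ.+ k ℕ.+ l)

    ∑⁴-summand≈R : ∑⁴ N summand ≈ R x y
    ∑⁴-summand≈R = begin
      ∑⁴ N summand
        ≈⟨ ∑⁴-cong N (λ i j k l → trans (sym (T-as-summand i j k l _)) (T-split i j k l)) ⟩
      ∑⁴ N (λ i j k l → T₀ i j k l + c * T₈ i j k l)
        ≈⟨ ∑⁴-distrib-+ N T₀ (λ i j k l → c * T₈ i j k l) ⟩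
      ∑⁴ N T₀ + ∑⁴ N (λ i j k l → c * T₈ i j k l)
        ≈⟨ +-congˡ (*-distribˡ-∑⁴ N c T₈) ⟨
      ∑⁴ N T₀ + c * ∑⁴ N T₈
        ≡⟨ ≡.cong₂ (λ s t → s + c * t) H-unfold H-unfold ⟨
      R x y ∎

    ∏*∏≈∑⁴-summand : ∏ N (λ k → 1# + x * q ^ (2 ℕ.* k ℕ.+ 1)) *
                     ∏ N (λ k → 1# + y * q ^ (4 ℕ.* k ℕ.+ 2)) ≈ ∑⁴ N summand
    ∏*∏≈∑⁴-summand = trans (R-product x y) (sym ∑⁴-summand≈R)

-- Cauchy products and truncated power series.

module Convolution (K : CommutativeSemiring 0ℓ 0ℓ) where
  open CommutativeSemiring K
  open SetoidReasoning setoid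
  open SemiringSolver K using (solve; _:=_; _:+_; _:*_)

  -- Σ_{i ≤ n} f i * g (n ∸ i), in a form that recurses on f = f 0 + t · tail f.
  conv : (f g : ℕ → Carrier) → ℕ → Carrier
  conv f g zero    = f 0 * g 0
  conv f g (suc n) = f 0 * g (suc n) + conv (λ i → f (suc i)) g n

  conv-cong : ∀ n {f f′ g g′} → (∀ i → i ≤ n → f i ≈ f′ i) → (∀ i → i ≤ n → g i ≈ g′ i) →
              conv f g n ≈ conv f′ g′ n
  conv-cong zero    f≈ g≈ = *-cong (f≈ 0 z≤n) (g≈ 0 z≤n)
  conv-cong (suc n) f≈ g≈ = +-cong (*-cong (f≈ 0 z≤n) (g≈ (suc n) ℕ.≤-refl))
    (conv-cong n (λ i i≤n → f≈ (suc i) (s≤s i≤n)) (λ i i≤n → g≈ i (ℕ.m≤n⇒m≤1+n i≤n)))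

  conv-distribʳ-+ : ∀ n f g h → conv (λ i → f i + g i) h n ≈ conv f h n + conv g h n
  conv-distribʳ-+ zero    f g h = distribʳ (h 0) (f 0) (g 0)
  conv-distribʳ-+ (suc n) f g h = trans (+-congˡ (conv-distribʳ-+ n _ _ h))
    (solve 5 (λ a b c d e → (a :+ b) :* c :+ (d :+ e) := (a :* c :+ d) :+ (b :* c :+ e))
      refl (f 0) (g 0) (h (suc n)) _ _)

  conv-*ˡ : ∀ n c f g → conv (λ i → c * f i) g n ≈ c * conv f g n
  conv-*ˡ zero    c f g = *-assoc c (f 0) (g 0)
  conv-*ˡ (suc n) c f g = trans (+-cong (*-assoc c _ _) (conv-*ˡ n c _ g)) (sym (distribˡ c _ _))

  conv-zeroˡ : ∀ n g → conv (λ _ → 0#) g n ≈ 0#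
  conv-zeroˡ zero    g = zeroˡ (g 0)
  conv-zeroˡ (suc n) g = trans (+-cong (zeroˡ _) (conv-zeroˡ n g)) (+-identityˡ 0#)

  -- The mirror image of the defining recursion, splitting off the last term instead of the first;
  -- comparing the two gives commutativity.
  conv-sucʳ : ∀ n f g → conv f g (suc n) ≈ conv f (λ i → g (suc i)) n + f (suc n) * g 0
  conv-sucʳ zero    f g = refl
  conv-sucʳ (suc n) f g = trans (+-congˡ (conv-sucʳ n _ g)) (sym (+-assoc _ _ _))

  conv-comm : ∀ n f g → conv f g n ≈ conv g f n
  conv-comm zero    f g = *-comm (f 0) (g 0)
  conv-comm (suc n) f g = begin
    f 0 * g (suc n) + conv (λ i → f (suc i)) g n   ≈⟨ +-cong (*-comm _ _) (conv-comm n _ g) ⟩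
    g (suc n) * f 0 + conv g (λ i → f (suc i)) n   ≈⟨ +-comm _ _ ⟩
    conv g (λ i → f (suc i)) n + g (suc n) * f 0   ≈⟨ conv-sucʳ n g f ⟨
    conv g f (suc n)                               ∎

  -- Induction along f = f 0 + t f′: the tail of `conv f g` is f 0 times the tail of `g`, plus
  -- `conv f′ g`, and linearity in the first argument separates the two.
  conv-assoc : ∀ n f g h → conv (conv f g) h n ≈ conv f (conv g h) n
  conv-assoc zero    f g h = *-assoc (f 0) (g 0) (h 0)
  conv-assoc (suc n) f g h = begin
    f 0 * g 0 * h (suc n) + conv (λ i → f 0 * g (suc i) + conv f′ g i) h n
      ≈⟨ +-congˡ (conv-distribʳ-+ n _ _ h) ⟩
    f 0 * g 0 * h (suc n) + (conv (λ i → f 0 * g (suc i)) h n + conv (conv f′ g) h n)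
      ≈⟨ +-congˡ (+-cong (conv-*ˡ n (f 0) _ h) (conv-assoc n f′ g h)) ⟩
    f 0 * g 0 * h (suc n) + (f 0 * conv (λ i → g (suc i)) h n + conv f′ (conv g h) n)
      ≈⟨ solve 5 (λ a b c d e → a :* b :* c :+ (a :* d :+ e) := a :* (b :* c :+ d) :+ e)
           refl (f 0) (g 0) (h (suc n)) _ _ ⟩
    f 0 * (g 0 * h (suc n) + conv (λ i → g (suc i)) h n) + conv f′ (conv g h) n ∎
    where
    f′ : ℕ → Carrier
    f′ i = f (suc i)

  const : Carrier → ℕ → Carrier
  const c zero    = c
  const c (suc _) = 0#

  t : ℕ → Carrier
  t zero    = 0#
  t (suc n) = const 1# n

  conv-const : ∀ n c f → conv (const c) f n ≈ c * f n
  conv-const zero    c f = refl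
  conv-const (suc n) c f = trans (+-congˡ (conv-zeroˡ n f)) (+-identityʳ _)

  conv-identityˡ : ∀ n f → conv (const 1#) f n ≈ f n
  conv-identityˡ n f = trans (conv-const n 1# f) (*-identityˡ (f n))

  delay : (ℕ → Carrier) → ℕ → Carrier
  delay f zero    = 0#
  delay f (suc n) = f n

  conv-t : ∀ n f → conv t f n ≈ delay f n
  conv-t zero    f = zeroˡ (f 0)
  conv-t (suc n) f = trans (+-cong (zeroˡ _) (conv-identityˡ n f)) (+-identityˡ _)

-- K[[t]]/(t^N), with power series kept as representatives.
truncatedSeries : CommutativeSemiring 0ℓ 0ℓ → ℕ → CommutativeSemiring 0ℓ 0ℓ
truncatedSeries K N = record
  { Carrier = ℕ → Carrier
  ; _≈_ = λ f g → ∀ n → n < N → f n ≈ g n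
  ; _+_ = λ f g n → f n + g n
  ; _*_ = conv
  ; 0# = λ _ → 0#
  ; 1# = const 1#
  ; isCommutativeSemiring = Biased.isCommutativeSemiringˡ record
    { +-isCommutativeMonoid = record
      { isMonoid = record
        { isSemigroup = record
          { isMagma = record
            { isEquivalence = isEquivalence′
            ; ∙-cong = λ e e′ n n<N → +-cong (e n n<N) (e′ n n<N)
            }
          ; assoc = λ f g h n _ → +-assoc (f n) (g n) (h n)
          }
        ; identity = (λ f n _ → +-identityˡ (f n)) , (λ f n _ → +-identityʳ (f n))
        }
      ; comm = λ f g n _ → +-comm (f n) (g n)
      }
    ; *-isCommutativeMonoid = record
      { isMonoid = record
        { isSemigroup = record
          { isMagma = record
            { isEquivalence = isEquivalence′
            ; ∙-cong = λ e e′ n n<N → conv-cong n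
                (λ i i≤n → e i (ℕ.≤-<-trans i≤n n<N)) (λ i i≤n → e′ i (ℕ.≤-<-trans i≤n n<N))
            }
          ; assoc = λ f g h n _ → conv-assoc n f g h
          }
        ; identity = (λ f n _ → conv-identityˡ n f)
                   , (λ f n _ → trans (conv-comm n f (const 1#)) (conv-identityˡ n f))
        }
      ; comm = λ f g n _ → conv-comm n f g
      }
    ; distribʳ = λ h f g n _ → conv-distribʳ-+ n f g h
    ; zeroˡ = λ f n _ → conv-zeroˡ n f
    }
  }
  where
  open CommutativeSemiring K
  open Convolution K
  isEquivalence′ : IsEquivalence (λ (f g : ℕ → Carrier) → ∀ n → n < N → f n ≈ g n)
  isEquivalence′ = record
    { refl = λ n _ → refl
    ; sym = λ e n n<N → sym (e n n<N)
    ; trans = λ e e′ n n<N → trans (e n n<N) (e′ n n<N)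
    }

-- Coefficients of products and of 1/(1 - q^d).

sumLe-suc : ∀ n f → sumLe (suc n) f ≡ f 0 ℤ.+ sumLe n (λ i → f (suc i))
sumLe-suc zero    f = ≡.refl
sumLe-suc (suc n) f = ≡.trans (≡.cong (ℤ._+ f (suc (suc n))) (sumLe-suc n f)) (ℤ.+-assoc (f 0) _ _)

sumLe-cong : ∀ n {f g} → (∀ i → f i ≡ g i) → sumLe n f ≡ sumLe n g
sumLe-cong zero    f≡g = f≡g 0
sumLe-cong (suc n) f≡g = ≡.cong₂ ℤ._+_ (sumLe-cong n f≡g) (f≡g (suc n))

module _ (K : CommutativeSemiring 0ℓ 0ℓ) where
  open CommutativeSemiring K
  open Convolution K

  -- Here `eval` extracts a coefficient from an element of the coefficient semiring. Applied once
  -- per variable, this turns the nested Cauchy product into the triple sum that defines `⊗`.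
  eval-conv : (eval : Carrier → ℤ) → (∀ u v → eval (u + v) ≡ eval u ℤ.+ eval v) →
              ∀ n f g → eval (conv f g n) ≡ sumLe n (λ i → eval (f i * g (n ∸ i)))
  eval-conv eval eval-+ zero    f g = ≡.refl
  eval-conv eval eval-+ (suc n) f g = ≡.trans (eval-+ _ _)
    (≡.trans (≡.cong (λ z → eval (f 0 * g (suc n)) ℤ.+ z) (eval-conv eval eval-+ n _ g)) (≡.sym (sumLe-suc n _)))

-- The test inside `geo`, named so that it can be compared with divisibility.
multiple? : ℕ → ℕ → Bool
multiple? d m = any (λ j → (d ℕ.* j) ≡ᵇ m) (upTo (suc m))

multiple?⇒∣ : ∀ d m → Bool.T (multiple? d m) → d ∣ m
multiple?⇒∣ d m p with satisfied (any⁻ _ (upTo (suc m)) p)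
... | j , dj≡m = divides j (≡.trans (≡.sym (ℕ.≡ᵇ⇒≡ _ m dj≡m)) (ℕ.*-comm d j))

-- The divisor is positive, so the quotient is at most `m` and lies in the range searched.
∣⇒multiple? : ∀ d m → suc d ∣ m → Bool.T (multiple? (suc d) m)
∣⇒multiple? d m (divides j m≡jd) = any⁺ _ (lose (∈-upTo⁺ (s≤s j≤m))
  (ℕ.≡⇒≡ᵇ _ m (≡.trans (ℕ.*-comm (suc d) j) (≡.sym m≡jd))))
  where
  j≤m : j ≤ m
  j≤m = ≡.subst (j ≤_) (≡.sym m≡jd) (ℕ.m≤m*n j (suc d))

T-⇔⇒≡ : ∀ {b c} → (Bool.T b → Bool.T c) → (Bool.T c → Bool.T b) → b ≡ c
T-⇔⇒≡ {true}  {true}  f g = ≡.refl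
T-⇔⇒≡ {true}  {false} f g = ⊥-elim (f _)
T-⇔⇒≡ {false} {true}  f g = ⊥-elim (g _)
T-⇔⇒≡ {false} {false} f g = ≡.refl

multiple?-zero : ∀ d → multiple? (suc d) 0 ≡ true
multiple?-zero d = T-⇔⇒≡ _ (λ _ → ∣⇒multiple? d 0 (suc d ∣0))

multiple?-small : ∀ d m → suc m < d → multiple? d (suc m) ≡ false
multiple?-small d m m<d = T-⇔⇒≡ (λ p → >⇒∤ m<d (multiple?⇒∣ d (suc m) p)) ⊥-elim

multiple?-+ : ∀ d m → multiple? (suc d) (suc d ℕ.+ m) ≡ multiple? (suc d) m
multiple?-+ d m = T-⇔⇒≡
  (λ p → ∣⇒multiple? d m (∣m+n∣m⇒∣n (multiple?⇒∣ _ _ p) ∣-refl))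
  (λ p → ∣⇒multiple? d _ (∣m∣n⇒∣m+n ∣-refl (multiple?⇒∣ _ m p)))

-- The coefficients of q^k f.
delays : ℕ → (ℕ → ℤ) → ℕ → ℤ
delays zero    f m       = f m
delays (suc k) f zero    = 0ℤ
delays (suc k) f (suc m) = delays k f m

delays-+ : ∀ k f m → delays k f (k ℕ.+ m) ≡ f m
delays-+ zero    f m = ≡.refl
delays-+ (suc k) f m = delays-+ k f m

delays-< : ∀ k f m → m < k → delays k f m ≡ 0ℤ
delays-< (suc k) f zero    _   = ≡.refl
delays-< (suc k) f (suc m) m<k = delays-< k f m (s<s⁻¹ m<k)

delays-zero : ∀ k m → delays k (λ _ → 0ℤ) m ≡ 0ℤ
delays-zero zero    m       = ≡.refl
delays-zero (suc k) zero    = ≡.refl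
delays-zero (suc k) (suc m) = delays-zero k m

-- The coefficients of 1/(1 - q^d) = 1 + q^d/(1 - q^d), with d for `suc d`: below d the only
-- multiple of d is 0, and from d on, subtracting d preserves divisibility by d.
geo₀-unfold : ∀ d m → geo (suc d) 0 0 m ≡
  Convolution.const ℤ.+-*-commutativeSemiring 1ℤ m ℤ.+ delays (suc d) (geo (suc d) 0 0) m
geo₀-unfold d m with ℕ.≤-<-connex (suc d) m
geo₀-unfold d zero    | inj₂ m<d = ≡.cong (if_then 1ℤ else 0ℤ) (multiple?-zero d)
geo₀-unfold d (suc m) | inj₂ m<d = ≡.trans
  (≡.cong (if_then 1ℤ else 0ℤ) (multiple?-small (suc d) m m<d))
  (≡.sym (≡.trans (ℤ.+-identityˡ _) (delays-< (suc d) _ (suc m) m<d)))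
geo₀-unfold d m | inj₁ d≤m with k , ≡.refl ← ℕ.m≤n⇒∃[o]m+o≡n d≤m = ≡.trans
  (≡.cong (if_then 1ℤ else 0ℤ) (multiple?-+ d k))
  (≡.sym (≡.trans (ℤ.+-identityˡ _) (delays-+ (suc d) _ k)))

-- Transfer to formal power series in x, y, q.

module Transfer (A B M : ℕ) where
  private N = suc M

  -- The nesting has x outermost, so that the carrier of `ℤqyx` is `Series` itself. Truncation at
  -- `N` makes q nilpotent; `A` and `B` bound the exponents of x and y at which coefficients are
  -- compared.
  ℤq ℤqy ℤqyx : CommutativeSemiring 0ℓ 0ℓ
  ℤq = truncatedSeries ℤ.+-*-commutativeSemiring N
  ℤqy = truncatedSeries ℤq B
  ℤqyx = truncatedSeries ℤqy A

  private
    module Cℤ = Convolution ℤ.+-*-commutativeSemiring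
    module Cq = Convolution ℤq
    module Cy = Convolution ℤqy
  open CommutativeSemiring ℤqyx
  open Exp ℤqyx
  open FiniteSums ℤqyx
  open SetoidReasoning setoid

  x y q : Series
  x = Cy.t
  y = Cy.const Cq.t
  q = Cy.const (Cq.const Cℤ.t)

  x-* : ∀ F → x * F ≈ Cy.delay F
  x-* F a _ = Cy.conv-t a F

  y-* : ∀ F → y * F ≈ λ a → Cq.delay (F a)
  y-* F a _ b b<B m m<N = ≡.trans (Cy.conv-const a Cq.t F b b<B m m<N) (Cq.conv-t b (F a) m m<N)

  q-* : ∀ F → q * F ≈ λ a b → Cℤ.delay (F a b)
  q-* F a _ b b<B m m<N = ≡.trans (Cy.conv-const a _ F b b<B m m<N)
    (≡.trans (Cq.conv-const b Cℤ.t (F a) m m<N) (Cℤ.conv-t m (F a b)))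

  q^-* : ∀ k F → q ^ k * F ≈ λ a b → delays k (F a b)
  q^-* zero    F = *-identityˡ F
  q^-* (suc k) F = trans (*-assoc q (q ^ k) F) (trans (q-* (q ^ k * F)) step)
    where
    step : (λ a b → Cℤ.delay ((q ^ k * F) a b)) ≈ (λ a b → delays (suc k) (F a b))
    step a a<A b b<B zero    _   = ≡.refl
    step a a<A b b<B (suc m) m<N = q^-* k F a a<A b b<B m (ℕ.<-trans (ℕ.n<1+n m) m<N)

  -- The two products have the same coefficients even before truncation, one as an iterated sum and
  -- the other in recursive form; the factors are then replaced by congruence.
  ⊗≈* : ∀ {F F′ G G′} → F ≈ F′ → G ≈ G′ → F ⊗ G ≈ F′ * G′
  ⊗≈* {F} {F′} {G} {G′} F≈ G≈ = trans exact (*-cong F≈ G≈)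
    where
    exact : F ⊗ G ≈ F * G
    exact a _ b _ m _ = ≡.sym
      (≡.trans (eval-conv ℤqy (λ H → H b m) (λ _ _ → ≡.refl) a F G) (sumLe-cong a λ i →
       ≡.trans (eval-conv ℤq (λ H → H m) (λ _ _ → ≡.refl) b (F i) (G (a ∸ i))) (sumLe-cong b λ j →
       eval-conv ℤ.+-*-commutativeSemiring (λ z → z) (λ _ _ → ≡.refl) m (F i j) (G (a ∸ i) (b ∸ j)))))

  one≈1 : one ≈ 1#
  one≈1 zero    _ zero    _ zero    _ = ≡.refl
  one≈1 zero    _ zero    _ (suc m) _ = ≡.refl
  one≈1 zero    _ (suc b) _ m       _ = ≡.refl
  one≈1 (suc a) _ b       _ m       _ = ≡.refl

  mono-suc₁ : ∀ e f g → mono (suc e) f g ≈ x * mono e f g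
  mono-suc₁ e f g = sym (trans (x-* _) λ where
    zero    _ b _ m _ → ≡.refl
    (suc a) _ b _ m _ → ≡.refl)

  mono-suc₂ : ∀ f g → mono 0 (suc f) g ≈ y * mono 0 f g
  mono-suc₂ f g = sym (trans (y-* _) λ where
    zero    _ zero    _ m _ → ≡.refl
    zero    _ (suc b) _ m _ → ≡.refl
    (suc a) _ zero    _ m _ → ≡.refl
    (suc a) _ (suc b) _ m _ → ≡.refl)

  mono-suc₃ : ∀ g → mono 0 0 (suc g) ≈ q * mono 0 0 g
  mono-suc₃ g = sym (trans (q-* _) λ where
    zero    _ zero    _ zero    _ → ≡.refl
    zero    _ zero    _ (suc m) _ → ≡.refl
    zero    _ (suc b) _ zero    _ → ≡.refl
    zero    _ (suc b) _ (suc m) _ → ≡.refl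
    (suc a) _ b       _ zero    _ → ≡.refl
    (suc a) _ b       _ (suc m) _ → ≡.refl)

  mono≈ : ∀ e f g → mono e f g ≈ x ^ e * (y ^ f * q ^ g)
  mono≈ (suc e) f g = trans (mono-suc₁ e f g) (trans (*-congˡ (mono≈ e f g)) (sym (*-assoc x _ _)))
  mono≈ zero f g = trans (mono₀ f) (sym (*-identityˡ _))
    where
    mono₀₀ : ∀ g → mono 0 0 g ≈ q ^ g
    mono₀₀ zero    = one≈1
    mono₀₀ (suc g) = trans (mono-suc₃ g) (*-congˡ (mono₀₀ g))
    mono₀ : ∀ f → mono 0 f g ≈ y ^ f * q ^ g
    mono₀ zero    = trans (mono₀₀ g) (sym (*-identityˡ _))
    mono₀ (suc f) = trans (mono-suc₂ f g) (trans (*-congˡ (mono₀ f)) (sym (*-assoc y _ _)))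

  q^N≈0 : q ^ N ≈ 0#
  q^N≈0 = trans (sym (*-identityʳ _)) (trans (q^-* N 1#) λ a _ b _ m m<N → delays-< N (1# a b) m m<N)

  geo-unfold : ∀ d → geo (suc d) ≈ 1# + q ^ suc d * geo (suc d)
  geo-unfold d = trans pointwise (+-congˡ {1#} (sym (q^-* (suc d) (geo (suc d)))))
    where
    pointwise : geo (suc d) ≈ 1# + (λ a b → delays (suc d) (geo (suc d) a b))
    pointwise zero    _ zero    _ m _ = geo₀-unfold d m
    pointwise zero    _ (suc b) _ m _ = ≡.sym (≡.trans (ℤ.+-identityˡ _) (delays-zero (suc d) m))
    pointwise (suc a) _ b       _ m _ = ≡.sym (≡.trans (ℤ.+-identityˡ _) (delays-zero (suc d) m))

  prodLt≈∏ : ∀ n {F G} → (∀ i → F i ≈ G i) → prodLt n F ≈ ∏ n G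
  prodLt≈∏ zero    F≈G = one≈1
  prodLt≈∏ (suc n) F≈G = ⊗≈* (prodLt≈∏ n F≈G) (F≈G n)

  sumSeriesLt≈∑ : ∀ n {F G} → (∀ i → F i ≈ G i) → sumSeriesLt n F ≈ ∑ n G
  sumSeriesLt≈∑ zero    F≈G = refl
  sumSeriesLt≈∑ (suc n) F≈G = +-cong (sumSeriesLt≈∑ n F≈G) (F≈G n)

  open Multisum ℤqyx q geo geo-unfold M q^N≈0 using (∏*∏≈∑⁴-summand; summand)

  lhsTrunc≈rhsTrunc : lhsTrunc N ≈ rhsTrunc N
  lhsTrunc≈rhsTrunc = begin
    lhsTrunc N
      ≈⟨ ⊗≈*
           (prodLt≈∏ N λ k → +-cong one≈1 (trans (mono≈ 1 0 (2 ℕ.* k ℕ.+ 1))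
             (*-cong (*-identityʳ x) (*-identityˡ _))))
           (prodLt≈∏ N λ k → +-cong one≈1 (trans (mono≈ 0 1 (4 ℕ.* k ℕ.+ 2))
             (trans (*-identityˡ _) (*-congʳ (*-identityʳ y))))) ⟩
    ∏ N (λ k → 1# + x * q ^ (2 ℕ.* k ℕ.+ 1)) * ∏ N (λ k → 1# + y * q ^ (4 ℕ.* k ℕ.+ 2))
      ≈⟨ ∏*∏≈∑⁴-summand x y ⟩
    ∑⁴ N (summand x y)
      ≈⟨ sumSeriesLt≈∑ N (λ i → sumSeriesLt≈∑ N λ j → sumSeriesLt≈∑ N λ k →
           sumSeriesLt≈∑ N λ l → term i j k l) ⟨
    rhsTrunc N ∎
    where
    term : ∀ i j k l → rhsTerm i j k l ≈ summand x y i j k l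
    term i j k l =
      ⊗≈* (⊗≈* (⊗≈* (⊗≈* (⊗≈* (mono≈ _ _ _) (+-cong one≈1 (mono≈ 2 1 _)))
        (prodLt≈∏ i λ _ → refl)) (prodLt≈∏ j λ _ → refl)) (prodLt≈∏ k λ _ → refl)) (prodLt≈∏ l λ _ → refl)

theorem1p1 : (a b m N : ℕ) → m < N → lhsTrunc N a b m ≡ rhsTrunc N a b m
theorem1p1 a b m (suc M) m<N =
  -- The bounds `suc a` and `suc b` are the least ones that retain the coefficient of x^a y^b.
  Transfer.lhsTrunc≈rhsTrunc (suc a) (suc b) M a (ℕ.n<1+n a) b (ℕ.n<1+n b) m m<N
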